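{- Let $B$ be a fixed bipartite graph whose vertex set is covered by pairwise vertex-disjoint edges together with possibly one (vertex-disjoint) star $S_j$ with $j\ge 2$ leaves. Then for integers $e=e_n$ with $e/n\to\infty$ and $e\le n^2/4$, $$ex_{bip}(n,e,B)=(1+o(1))\,N(B,B^e_n)\qquad(n\to\infty).$$
   Context: $S_j$ denotes the star with $j$ leaves. For graphs $H,G$, $N(H,G)$ is the number of subgraphs of $G$ isomorphic to $H$. $ex_{bip}(n,e,H)=\max\{N(H,G): G \text{ bipartite}, |V(G)|=n, |E(G)|=e\}$. For positive integers $n,e$ with $e\le n^2/4$, let $t$ be the smallest positive integer $i$ with $i(n-i)\ge e$; the graph $B^e_n$ is obtained from $K_{t,n-t}$ by picking a vertex of degree $n-t$ and deleting $t(n-t)-e$ of its edges. -}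

module Defs where

open import Data.Bool using (Bool; true; false; _∧_; _∨_; not; if_then_else_)
import Data.Bool as Bool
open import Data.Nat using (ℕ; zero; suc; _+_; _*_; _∸_; _⊔_; _≤ᵇ_; _<ᵇ_; _≡ᵇ_)
open import Data.Fin using (Fin; toℕ)
import Data.Fin as Fin
open import Data.List using (List; []; _∷_; map; concatMap; filterᵇ; deduplicate; allFin; upTo; foldr; length)
open import Data.Bool.ListAction using (all; any)
open import Data.Vec using (Vec; lookup; tabulate)
import Data.Vec as Vec
import Data.Vec.Properties as VecP
import Data.Product.Properties as ProdP
open import Data.Product using (Σ; _×_; _,_; ∃-syntax)
open import Relation.Nullary.Decidable using (⌊_⌋; Dec)
open import Data.Sum using (_⊎_)
open import Relation.Binary.PropositionalEquality using (_≡_; _≢_)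

Adj : ℕ → Set
Adj n = Vec (Vec Bool n) n

adj : ∀ {n} → Adj n → Fin n → Fin n → Bool
adj A i j = lookup (lookup A i) j

SimpleGraph : ∀ {n} → Adj n → Set
SimpleGraph A = (∀ i j → adj A i j ≡ adj A j i) × (∀ i → adj A i i ≡ false)

Bipartite : ∀ {n} → Adj n → Set
Bipartite {n} A = Σ (Fin n → Bool) λ c → (∀ (i j : Fin n) → adj A i j ≡ true → c i ≢ c j)

-- The vertex set of B is covered by pairwise vertex-disjoint edges (a
-- perfect matching of the vertices not in the star), together with possibly
-- one vertex-disjoint star S_j (centre z, j ≥ 2 leaves), all being
-- subgraphs of B.
--  inStar v : v belongs to the star;  partner v : the matching partner of v.
CoveredByEdgesAndStar : ∀ {n} → Adj n → Set
CoveredByEdgesAndStar {n} A =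
  Σ (Fin n → Bool) λ inStar → Σ (Fin n → Fin n) λ partner →
    (∀ v → inStar v ≡ false →
        (partner v ≢ v) × (inStar (partner v) ≡ false) ×
        (partner (partner v) ≡ v) × (adj A v (partner v) ≡ true))
    ×
    ((∀ v → inStar v ≡ false)
     ⊎
     (Σ (Fin n) λ z → Σ (Fin n) λ l₁ → Σ (Fin n) λ l₂ →
        (inStar z ≡ true) × (inStar l₁ ≡ true) × (inStar l₂ ≡ true) ×
        (l₁ ≢ z) × (l₂ ≢ z) × (l₁ ≢ l₂) ×
        (∀ w → inStar w ≡ true → w ≢ z → adj A z w ≡ true)))

_==F_ : ∀ {n} → Fin n → Fin n → Bool
i ==F j = ⌊ i Fin.≟ j ⌋

_==B_ : Bool → Bool → Bool
a ==B b = ⌊ a Bool.≟ b ⌋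

vecs : ∀ {A : Set} → List A → (h : ℕ) → List (Vec A h)
vecs xs zero = Vec.[] ∷ []
vecs xs (suc h) = concatMap (λ x → map (x Vec.∷_) (vecs xs h)) xs

bools : List Bool
bools = true ∷ false ∷ []

allAdj : (n : ℕ) → List (Adj n)
allAdj n = vecs (vecs bools n) n

isSimpleᵇ : ∀ {n} → Adj n → Bool
isSimpleᵇ {n} A =
  all (λ i → all (λ j → adj A i j ==B adj A j i) (allFin n)) (allFin n)
  ∧ all (λ i → not (adj A i i)) (allFin n)

isBipartiteᵇ : ∀ {n} → Adj n → Bool
isBipartiteᵇ {n} A =
  any (λ c → all (λ i → all (λ j →
        not (adj A i j) ∨ not (lookup c i ==B lookup c j)) (allFin n)) (allFin n))
      (vecs bools n)

pairs : (n : ℕ) → List (Fin n × Fin n)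
pairs n = concatMap (λ i → concatMap (λ j →
            if toℕ i <ᵇ toℕ j then (i , j) ∷ [] else []) (allFin n)) (allFin n)

edgeCount : ∀ {n} → Adj n → ℕ
edgeCount {n} A = length (filterᵇ (λ p → adj A (Data.Product.proj₁ p) (Data.Product.proj₂ p)) (pairs n))
  where import Data.Product

-- N(H,G): the number of subgraphs of G isomorphic to H.
-- A subgraph is a pair (vertex set, edge set); the subgraphs of G
-- isomorphic to H are exactly the images (f[V(H)], f[E(H)]) of injective
-- maps f : V(H) → V(G) sending edges of H to edges of G.  We count the
-- distinct such images.

Subgraph : ℕ → Set
Subgraph n = Vec Bool n × Adj n

isEmbeddingᵇ : ∀ {h n} → Adj h → Adj n → Vec (Fin n) h → Bool
isEmbeddingᵇ {h} {n} H G f =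
  all (λ u → all (λ w →
      (u ==F w ∨ not (lookup f u ==F lookup f w))
      ∧ (not (adj H u w) ∨ adj G (lookup f u) (lookup f w))) (allFin h)) (allFin h)

image : ∀ {h n} → Adj h → Vec (Fin n) h → Subgraph n
image {h} {n} H f =
  tabulate (λ v → any (λ u → lookup f u ==F v) (allFin h)) ,
  tabulate (λ a → tabulate (λ b →
    any (λ u → any (λ w → adj H u w ∧ (lookup f u ==F a) ∧ (lookup f w ==F b))
        (allFin h)) (allFin h)))

subgraphDec : ∀ {n} (x y : Subgraph n) → Dec (x ≡ y)
subgraphDec {n} = ProdP.≡-dec (VecP.≡-dec Bool._≟_) (VecP.≡-dec (VecP.≡-dec Bool._≟_))

copies : ∀ {h n} → Adj h → Adj n → List (Subgraph n)
copies {h} {n} H G =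
  deduplicate subgraphDec (map (image H) (filterᵇ (isEmbeddingᵇ H G) (vecs (allFin n) h)))

N : ∀ {h n} → Adj h → Adj n → ℕ
N H G = length (copies H G)

-- ex_bip(n,e,H) = max { N(H,G) : G bipartite, |V(G)| = n, |E(G)| = e }
-- (maximum over all simple bipartite graphs on vertex set Fin n with e edges;
-- 0 if there is none).

exBip : ℕ → ℕ → ∀ {h} → Adj h → ℕ
exBip n e H =
  foldr _⊔_ 0 (map (N H)
    (filterᵇ (λ G → isSimpleᵇ G ∧ isBipartiteᵇ G ∧ (edgeCount G ≡ᵇ e)) (allAdj n)))

firstOr : ℕ → (ℕ → Bool) → List ℕ → ℕ
firstOr d p [] = d
firstOr d p (x ∷ xs) = if p x then x else firstOr d p xs

-- t = smallest positive integer i with i(n-i) ≥ e  (searched in 1..n;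
-- for e ≤ n²/4 such an i ≤ n exists whenever n ≥ 1)
tParam : ℕ → ℕ → ℕ
tParam n e = firstOr n (λ i → e ≤ᵇ i * (n ∸ i)) (map suc (upTo n))

-- K_{t,n-t} with parts {0,…,t-1} and {t,…,n-1}; vertex 0 (degree n-t)
-- loses its edges to the d = t(n-t)-e vertices t,…,t+d-1.
Ben : (n e : ℕ) → Adj n
Ben n e = tabulate (λ i → tabulate (λ j → half i j ∨ half j i))
  where
    t = tParam n e
    d = t * (n ∸ t) ∸ e
    inA : Fin n → Bool
    inA i = toℕ i <ᵇ t
    deleted : Fin n → Fin n → Bool
    deleted i j = (toℕ i ≡ᵇ 0) ∧ (toℕ j <ᵇ t + d)
    half : Fin n → Fin n → Bool
    half i j = inA i ∧ not (inA j) ∧ not (deleted i j)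

{-# OPTIONS --safe #-}
module Submission where

-- Fix a bipartition of G and classify the embeddings of B by the set c of
-- vertices sent to the side of the star centre. Choosing an oriented edge of G for every
-- matching edge of B gives at most e^m · Σ_v deg(v)^j embeddings of class c. Both
-- sides of G have at least t vertices, so deg(v) ≤ n - t, and deg(x) + deg(y) ≤ n
-- along an edge xy; by convexity
--   Σ_v deg(v)^j = Σ_{xy ∈ E} (deg(x)^(j-1) + deg(y)^(j-1)) ≤ e · ((n-t)^(j-1) + t^(j-1)).
-- As e ≤ t(n-t), this is at most the number of maps of class c into K_{t,n-t}.
-- B^e_n contains K_{t-1,n-t}, whose injective maps of class c are asymptotically as
-- numerous since t → ∞. Dividing by |Aut B| passes from embeddings to copies.

open import Defs
open import Data.Bool using (Bool; true; false; T; T?; if_then_else_; not; _∧_; _∨_)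
open import Data.Bool.Properties using (T-∧; T-∨; T-≡; T-not-≡; ⇔→≡; ∧-identityʳ; ∧-zeroʳ; ∨-comm; ∨-zeroʳ; ¬-not)
import Data.Bool as Bool
open import Data.Bool.ListAction using (all; any)
open import Data.Empty using (⊥; ⊥-elim)
open import Data.Nat
open import Data.Nat.Properties
open import Data.Nat.Tactic.RingSolver using (solve-∀)
open import Data.Nat.ListAction using () renaming (sum to sumᴸ)
open import Data.Fin using (Fin; toℕ) renaming (zero to fzero; suc to fsuc)
open import Data.Fin.Permutation using (permutation)
import Data.Fin as Fin
import Data.Fin.Properties as Fin
open import Data.List using (List; []; _∷_; map; concatMap; filterᵇ; allFin; length; cartesianProductWith; foldr; applyUpTo; _++_)
import Data.List as List
import Data.List.Properties as List
open import Data.List.Membership.Propositional using (_∈_; find; lose)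
open import Data.List.Membership.Propositional.Properties
open import Data.List.Relation.Binary.Subset.Propositional using (_⊆_)
open import Data.List.Relation.Unary.All as All using (All; []; _∷_)
import Data.List.Relation.Unary.All.Properties as All
open import Data.List.Relation.Unary.Any using (here; there)
import Data.List.Relation.Unary.Any as Any
import Data.List.Relation.Unary.Any.Properties as Any
open import Data.List.Relation.Unary.AllPairs using ([]; _∷_)
open import Data.List.Relation.Unary.Unique.Propositional using (Unique)
import Data.List.Relation.Unary.Unique.Propositional.Properties as Unique
open import Data.Product using (_×_; _,_; proj₁; proj₂; ∃; ∃-syntax)
open import Data.Sum using (_⊎_; inj₁; inj₂)
open import Data.Vec using (Vec; lookup; tabulate) renaming ([] to []ᵛ; _∷_ to _∷ᵛ_)
import Data.Vec.Properties as Vec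
open import Data.Vec.Functional using (Vector)
open import Function using (_∘_; Equivalence; mk⇔)
open import Relation.Binary.Definitions using (DecidableEquality; tri<; tri≈; tri>)
open import Relation.Binary.PropositionalEquality
open import Relation.Nullary using (yes; no; contradiction)
open import Relation.Nullary.Decidable using (⌊_⌋; toWitness; fromWitness)

open import Algebra.Properties.Semiring.Sum +-*-semiring
  using (∑-distrib-+; ∑-comm; sum-permute; *-distribˡ-sum; *-distribʳ-sum)
  renaming (sum to ∑; sum-cong-≗ to ∑-cong)
open import Algebra.Properties.CommutativeMonoid.Sum *-1-commutativeMonoid
  using () renaming (sum to ∏; sum-cong-≗ to ∏-cong; ∑-distrib-+ to ∏-distrib-*)

open ≤-Reasoning
open Equivalence

-- The classes keep the constant sharp. Edges of `B` outside the cover can tie the orientations of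
-- different matching edges together, so letting every matching edge run both ways would give a
-- factor `(2e)^m` that may be too large by a constant factor. A class fixes all orientations
-- relative to the centre and leaves `e` candidates per matching edge. A class that occurs in some
-- bipartite `G` is a proper two-colouring of `B`, and every such colouring can be realised in
-- `B^e_n`, so the comparison is made class by class. A class does not tell on which side of `G` the
-- centre lies. In `K_{t,n-t}` the two positions of the centre account for the two terms
-- `(n-t)^(j-1)` and `t^(j-1)`, and it is their sum that is bounded for `G`. That `t` tends to
-- infinity comes from `e ≤ t(n-t) ≤ tn` and `e/n → ∞`. Limits and quotients are avoided throughout:
-- a relative error `1/(k+1)` is the inequality between `k` times one count and `k+1` times the
-- other.

private variable
  A C : Set
  m n : ℕ

-- Finite sums and products, and counting in lists

𝟙 : Bool → ℕ
𝟙 b = if b then 1 else 0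

𝟙≤1 : ∀ b → 𝟙 b ≤ 1
𝟙≤1 false = z≤n
𝟙≤1 true = ≤-refl

∑-mono : {f g : Vector ℕ n} → (∀ i → f i ≤ g i) → ∑ f ≤ ∑ g
∑-mono {zero} f≤g = z≤n
∑-mono {suc n} f≤g = +-mono-≤ (f≤g fzero) (∑-mono (f≤g ∘ fsuc))

∏-mono : {f g : Vector ℕ n} → (∀ i → f i ≤ g i) → ∏ f ≤ ∏ g
∏-mono {zero} f≤g = ≤-refl
∏-mono {suc n} f≤g = *-mono-≤ (f≤g fzero) (∏-mono (f≤g ∘ fsuc))

∑-const : ∀ n c → ∑ {n} (λ _ → c) ≡ n * c
∑-const zero c = refl
∑-const (suc n) c = cong (c +_) (∑-const n c)

term≤∑ : (f : Vector ℕ n) → ∀ i → f i ≤ ∑ f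
term≤∑ f fzero = m≤m+n _ _
term≤∑ f (fsuc i) = ≤-trans (term≤∑ (f ∘ fsuc) i) (m≤n+m _ _)

∏-^ : ∀ a (f : Vector ℕ n) → ∏ (λ i → a ^ f i) ≡ a ^ ∑ f
∏-^ {zero} a f = refl
∏-^ {suc n} a f = trans (cong (a ^ f fzero *_) (∏-^ a (f ∘ fsuc))) (sym (^-distribˡ-+-* a (f fzero) _))

∑-𝟙-≟ : (i : Fin n) → ∑ (λ j → 𝟙 (i ==F j)) ≡ 1
∑-𝟙-≟ {suc n} fzero = cong suc (trans (∑-const n 0) (*-zeroʳ n))
∑-𝟙-≟ {suc n} (fsuc i) = trans (∑-cong (λ j → cong 𝟙 (lem i j))) (∑-𝟙-≟ i)
  where
  lem : ∀ {n} (i j : Fin n) → (fsuc i ==F fsuc j) ≡ (i ==F j)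
  lem i j with i Fin.≟ j
  ... | yes _ = refl
  ... | no _ = refl

count : (A → Bool) → List A → ℕ
count p xs = length (filterᵇ p xs)

count-∷ : (p : A → Bool) → ∀ x xs → count p (x ∷ xs) ≡ 𝟙 (p x) + count p xs
count-∷ p x xs with p x
... | true = refl
... | false = refl

count-++ : (p : A → Bool) → ∀ xs ys → count p (xs ++ ys) ≡ count p xs + count p ys
count-++ p [] ys = refl
count-++ p (x ∷ xs) ys rewrite count-∷ p x (xs ++ ys) | count-∷ p x xs | count-++ p xs ys =
  sym (+-assoc (𝟙 (p x)) _ _)

count-map : (p : C → Bool) (f : A → C) → ∀ xs → count p (map f xs) ≡ count (p ∘ f) xs
count-map p f [] = refl
count-map p f (x ∷ xs) rewrite count-∷ p (f x) (map f xs) | count-∷ (p ∘ f) x xs | count-map p f xs = refl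

sumᴸ-tabulate : (h : A → ℕ) (f : Fin n → A) → sumᴸ (map h (List.tabulate f)) ≡ ∑ (h ∘ f)
sumᴸ-tabulate {n = zero} h f = refl
sumᴸ-tabulate {n = suc n} h f = cong (h (f fzero) +_) (sumᴸ-tabulate h (f ∘ fsuc))

count-concatMap : (p : C → Bool) (f : A → List C) → ∀ xs → count p (concatMap f xs) ≡ sumᴸ (map (count p ∘ f) xs)
count-concatMap p f [] = refl
count-concatMap p f (x ∷ xs) =
  trans (count-++ p (f x) (concatMap f xs)) (cong (count p (f x) +_) (count-concatMap p f xs))

count-concatMap-allFin : (p : C → Bool) (f : Fin n → List C) →
  count p (concatMap f (allFin n)) ≡ ∑ (λ i → count p (f i))
count-concatMap-allFin {n = n} p f = trans (count-concatMap p f (allFin n)) (sumᴸ-tabulate (count p ∘ f) Function.id)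

count-allFin : (p : Fin n → Bool) → count p (allFin n) ≡ ∑ (λ i → 𝟙 (p i))
count-allFin p = go p Function.id
  where
  go : ∀ {m} (p : A → Bool) (f : Fin m → A) → count p (List.tabulate f) ≡ ∑ (λ i → 𝟙 (p (f i)))
  go {m = zero} p f = refl
  go {m = suc m} p f = trans (count-∷ p (f fzero) _) (cong (𝟙 (p (f fzero)) +_) (go p (f ∘ fsuc)))

∈-filterᵇ⁺ : (p : A → Bool) → ∀ {x xs} → x ∈ xs → T (p x) → x ∈ filterᵇ p xs
∈-filterᵇ⁺ p = ∈-filter⁺ (T? ∘ p)

∈-filterᵇ⁻ : (p : A → Bool) → ∀ {x xs} → x ∈ filterᵇ p xs → x ∈ xs × T (p x)
∈-filterᵇ⁻ p = ∈-filter⁻ (T? ∘ p)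

filterᵇ-unique : (p : A → Bool) → ∀ {xs} → Unique xs → Unique (filterᵇ p xs)
filterᵇ-unique p = Unique.filter⁺ (T? ∘ p)

-- Cutting `ys` at an occurrence of the head leaves a list shorter by one that still contains the
-- tail, because the head does not recur there. Cardinalities are compared below through such
-- inclusions.
unique-⊆⇒length≤ : {xs ys : List A} → Unique xs → xs ⊆ ys → length xs ≤ length ys
unique-⊆⇒length≤ {xs = []} _ _ = z≤n
unique-⊆⇒length≤ {xs = x ∷ xs} (x∉ ∷ u) sub with ∈-∃++ (sub (here refl))
... | as , bs , refl = begin
  suc (length xs) ≤⟨ s≤s (unique-⊆⇒length≤ u sub′) ⟩
  suc (length (as ++ bs)) ≡⟨ cong suc (List.length-++ as) ⟩
  suc (length as + length bs) ≡⟨ +-suc (length as) (length bs) ⟨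
  length as + suc (length bs) ≡⟨ List.length-++ as ⟨
  length (as ++ x ∷ bs) ∎
  where
  sub′ : xs ⊆ as ++ bs
  sub′ {y} y∈ with ∈-++⁻ as (sub (there y∈))
  ... | inj₁ y∈as = ∈-++⁺ˡ y∈as
  ... | inj₂ (here refl) = contradiction refl (All.lookup x∉ y∈)
  ... | inj₂ (there y∈bs) = ∈-++⁺ʳ as y∈bs

module _ (_≟_ : DecidableEquality C) where

  sum-𝟙-unique : ∀ {ys} → Unique ys → ∀ {c} → c ∈ ys → sumᴸ (map (λ y → 𝟙 ⌊ c ≟ y ⌋) ys) ≡ 1
  sum-𝟙-unique (y∉ ∷ u) {c} (here refl) with c ≟ c
  ... | yes _ = cong suc (zeros y∉)
    where
    zeros : ∀ {ys} → All (c ≢_) ys → sumᴸ (map (λ y → 𝟙 ⌊ c ≟ y ⌋) ys) ≡ 0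
    zeros [] = refl
    zeros {y ∷ _} (c≢y ∷ c∉) with c ≟ y
    ... | yes c≡y = contradiction c≡y c≢y
    ... | no _ = zeros c∉
  ... | no c≢c = contradiction refl c≢c
  sum-𝟙-unique {y ∷ _} (y∉ ∷ u) {c} (there c∈) with c ≟ y
  ... | yes refl = contradiction refl (All.lookup y∉ c∈)
  ... | no _ = sum-𝟙-unique u c∈

  -- Each element is counted once, since exactly one entry of the duplicate-free `ys` equals its
  -- value. Applied with `φ` the image (copies), the side pattern (classes) and the position of the
  -- star centre.
  length-fibres : (φ : A → C) → ∀ {ys} → Unique ys → ∀ xs → (∀ {x} → x ∈ xs → φ x ∈ ys) →
    length xs ≡ sumᴸ (map (λ y → count (λ x → ⌊ φ x ≟ y ⌋) xs) ys)
  length-fibres φ {ys} u [] _ = sym (zeros ys)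
    where
    zeros : ∀ (ys : List C) → sumᴸ (map (λ _ → 0) ys) ≡ 0
    zeros [] = refl
    zeros (_ ∷ ys) = zeros ys
  length-fibres φ {ys} u (x ∷ xs) φ∈ = sym (trans (split ys)
    (cong₂ _+_ (sum-𝟙-unique u (φ∈ (here refl))) (sym (length-fibres φ u xs (φ∈ ∘ there)))))
    where
    split : ∀ ys → sumᴸ (map (λ y → count (λ x → ⌊ φ x ≟ y ⌋) (x ∷ xs)) ys) ≡
      sumᴸ (map (λ y → 𝟙 ⌊ φ x ≟ y ⌋) ys) + sumᴸ (map (λ y → count (λ x → ⌊ φ x ≟ y ⌋) xs) ys)
    split [] = refl
    split (y ∷ ys) rewrite count-∷ (λ x → ⌊ φ x ≟ y ⌋) x xs | split ys =
      +-interchange (𝟙 ⌊ φ x ≟ y ⌋) _ _ _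
      where
      +-interchange : ∀ a b c d → (a + b) + (c + d) ≡ (a + c) + (b + d)
      +-interchange a b c d = trans (+-assoc a b _) (trans (cong (a +_)
        (trans (sym (+-assoc b c d)) (trans (cong (_+ d) (+-comm b c)) (+-assoc c b d)))) (sym (+-assoc a c _)))

sumᴸ-mono : {f g : A → ℕ} → ∀ xs → (∀ {x} → x ∈ xs → f x ≤ g x) → sumᴸ (map f xs) ≤ sumᴸ (map g xs)
sumᴸ-mono [] _ = z≤n
sumᴸ-mono (x ∷ xs) f≤g = +-mono-≤ (f≤g (here refl)) (sumᴸ-mono xs (f≤g ∘ there))

sumᴸ-const : (f : A → ℕ) (c : ℕ) → ∀ xs → (∀ {x} → x ∈ xs → f x ≡ c) → sumᴸ (map f xs) ≡ length xs * c
sumᴸ-const f c [] _ = refl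
sumᴸ-const f c (x ∷ xs) f≡c = cong₂ _+_ (f≡c (here refl)) (sumᴸ-const f c xs (f≡c ∘ there))

sumᴸ-* : (k : ℕ) (f : A → ℕ) → ∀ xs → k * sumᴸ (map f xs) ≡ sumᴸ (map (λ x → k * f x) xs)
sumᴸ-* k f [] = *-zeroʳ k
sumᴸ-* k f (x ∷ xs) = trans (*-distribˡ-+ k (f x) _) (cong (k * f x +_) (sumᴸ-* k f xs))

-- Unlike in `vecs`, the list may vary with the coordinate: in `choices` the supply depends on the
-- role of each vertex of `B`.
vectors : (Fin n → List A) → List (Vec A n)
vectors {zero} L = []ᵛ ∷ []
vectors {suc n} L = cartesianProductWith _∷ᵛ_ (L fzero) (vectors (L ∘ fsuc))

length-vectors : (L : Fin n → List A) → length (vectors L) ≡ ∏ (length ∘ L)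
length-vectors {zero} L = refl
length-vectors {suc n} L = trans (len (L fzero) _) (cong (length (L fzero) *_) (length-vectors (L ∘ fsuc)))
  where
  len : ∀ {A B C : Set} {f : A → B → C} xs ys → length (cartesianProductWith f xs ys) ≡ length xs * length ys
  len [] ys = refl
  len {f = f} (x ∷ xs) ys = trans (List.length-++ (map (f x) ys)) (cong₂ _+_ (List.length-map (f x) ys) (len xs ys))

∈-vectors : (L : Fin n → List A) (v : Vec A n) → (∀ i → lookup v i ∈ L i) → v ∈ vectors L
∈-vectors L []ᵛ _ = here refl
∈-vectors L (x ∷ᵛ v) v∈ = ∈-cartesianProductWith⁺ _∷ᵛ_ (v∈ fzero) (∈-vectors (L ∘ fsuc) v (v∈ ∘ fsuc))

vecs≡vectors : (xs : List A) → ∀ h → vecs xs h ≡ vectors {h} (λ _ → xs)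
vecs≡vectors xs zero = refl
vecs≡vectors xs (suc h) = trans (concatMap≡ xs) (cong (cartesianProductWith _∷ᵛ_ xs) (vecs≡vectors xs h))
  where
  concatMap≡ : ∀ xs {ys} → concatMap (λ x → map (x ∷ᵛ_) ys) xs ≡ cartesianProductWith _∷ᵛ_ xs ys
  concatMap≡ [] = refl
  concatMap≡ (x ∷ xs) {ys} = cong (map (x ∷ᵛ_) ys ++_) (concatMap≡ xs)

∈-vecs : {xs : List A} → (∀ x → x ∈ xs) → ∀ {h} (v : Vec A h) → v ∈ vecs xs h
∈-vecs {xs = xs} all∈ {h} v = subst (v ∈_) (sym (vecs≡vectors xs h)) (∈-vectors (λ _ → xs) v (λ i → all∈ (lookup v i)))

vecs-unique : {xs : List A} → Unique xs → ∀ h → Unique (vecs xs h)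
vecs-unique {xs = xs} u h = subst Unique (sym (vecs≡vectors xs h)) (go h)
  where
  go : ∀ h → Unique (vectors {h} (λ _ → xs))
  go zero = [] ∷ []
  go (suc h) = Unique.cartesianProductWith⁺ _∷ᵛ_ Vec.∷-injective u (go h)

functions : ∀ n h → List (Vec (Fin n) h)
functions n h = vecs (allFin n) h

∈-functions : (f : Vec (Fin n) m) → f ∈ functions n m
∈-functions = ∈-vecs ∈-allFin

∈-bools : ∀ b → b ∈ bools
∈-bools true = here refl
∈-bools false = there (here refl)

bools-unique : Unique bools
bools-unique = ((λ ()) ∷ []) ∷ ([] ∷ [])

all-allFin⁻ : (p : Fin n → Bool) → T (all p (allFin n)) → ∀ i → T (p i)
all-allFin⁻ {n} p t i = All.lookup (All.all⁺ p (allFin n) t) (∈-allFin i)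

all-allFin⁺ : (p : Fin n → Bool) → (∀ i → T (p i)) → T (all p (allFin n))
all-allFin⁺ {n} p t = All.all⁻ p {allFin n} (All.tabulate (λ {i} _ → t i))

any-allFin⁻ : (p : Fin n → Bool) → T (any p (allFin n)) → ∃ λ i → T (p i)
any-allFin⁻ {n} p t = let i , _ , pi = find (Any.any⁻ p (allFin n) t) in i , pi

any-allFin⁺ : (p : Fin n → Bool) → ∀ i → T (p i) → T (any p (allFin n))
any-allFin⁺ p i t = Any.any⁺ p (Any.map (λ { refl → t }) (∈-allFin i))

-- Embeddings and copies

record IsEmbedding {b n} (H : Adj b) (G : Adj n) (f : Vec (Fin n) b) : Set where
  constructor embedding
  field
    injective : ∀ u w → lookup f u ≡ lookup f w → u ≡ w
    edges : ∀ u w → T (adj H u w) → T (adj G (lookup f u) (lookup f w))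

open IsEmbedding

isEmbeddingᵇ⁻ : ∀ {b n} (H : Adj b) (G : Adj n) f → T (isEmbeddingᵇ H G f) → IsEmbedding H G f
isEmbeddingᵇ⁻ H G f t = embedding inj hom
  where
  both : ∀ u w → T ((u ==F w) ∨ not (lookup f u ==F lookup f w)) ×
                 T (not (adj H u w) ∨ adj G (lookup f u) (lookup f w))
  both u w = to T-∧ (all-allFin⁻ _ (all-allFin⁻ _ t u) w)
  inj : ∀ u w → lookup f u ≡ lookup f w → u ≡ w
  inj u w eq with to (T-∨ {u ==F w}) (proj₁ (both u w))
  ... | inj₁ u≡w = toWitness u≡w
  ... | inj₂ fu≢fw with lookup f u Fin.≟ lookup f w
  ...   | no fu≢ = contradiction eq fu≢
  hom : ∀ u w → T (adj H u w) → T (adj G (lookup f u) (lookup f w))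
  hom u w a with adj H u w | proj₂ (both u w)
  ... | true | t′ = t′

isEmbeddingᵇ⁺ : ∀ {b n} (H : Adj b) (G : Adj n) f → IsEmbedding H G f → T (isEmbeddingᵇ H G f)
isEmbeddingᵇ⁺ H G f (embedding inj hom) =
  all-allFin⁺ _ λ u → all-allFin⁺ _ λ w → from T-∧ (left u w , right u w)
  where
  left : ∀ u w → T ((u ==F w) ∨ not (lookup f u ==F lookup f w))
  left u w with u Fin.≟ w | lookup f u Fin.≟ lookup f w
  ... | yes _ | _ = _
  ... | no _ | no _ = _
  ... | no u≢w | yes eq = contradiction (inj u w eq) u≢w
  right : ∀ u w → T (not (adj H u w) ∨ adj G (lookup f u) (lookup f w))
  right u w with adj H u w in eq
  ... | false = _
  ... | true = hom u w (from T-≡ eq)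

embeddings : ∀ {b n} → Adj b → Adj n → List (Vec (Fin n) b)
embeddings {b} {n} H G = filterᵇ (isEmbeddingᵇ H G) (functions n b)

embeddings-unique : ∀ {b n} (H : Adj b) (G : Adj n) → Unique (embeddings H G)
embeddings-unique {b} {n} H G = filterᵇ-unique (isEmbeddingᵇ H G) (vecs-unique (Unique.allFin⁺ n) b)

∈-embeddings⁻ : ∀ {b n} (H : Adj b) (G : Adj n) {f} → f ∈ embeddings H G → IsEmbedding H G f
∈-embeddings⁻ {b} {n} H G {f} f∈ = isEmbeddingᵇ⁻ H G f (proj₂ (∈-filterᵇ⁻ (isEmbeddingᵇ H G) {xs = functions n b} f∈))

∈-embeddings⁺ : ∀ {b n} (H : Adj b) (G : Adj n) {f} → IsEmbedding H G f → f ∈ embeddings H G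
∈-embeddings⁺ H G {f} emb = ∈-filterᵇ⁺ (isEmbeddingᵇ H G) (∈-functions f) (isEmbeddingᵇ⁺ H G f emb)

T⇔T⇒≡ : ∀ {a b} → (T a → T b) → (T b → T a) → a ≡ b
T⇔T⇒≡ a⇒b b⇒a = ⇔→≡ (mk⇔ (λ a → to T-≡ (a⇒b (from T-≡ a))) (λ b → to T-≡ (b⇒a (from T-≡ b))))

vec-ext : {v w : Vec A n} → (∀ i → lookup v i ≡ lookup w i) → v ≡ w
vec-ext {v = []ᵛ} {[]ᵛ} _ = refl
vec-ext {v = _ ∷ᵛ _} {_ ∷ᵛ _} eq = cong₂ _∷ᵛ_ (eq fzero) (vec-ext (eq ∘ fsuc))

adj-tabulate : (E : Fin n → Fin n → Bool) → ∀ x y → adj (tabulate λ x → tabulate (E x)) x y ≡ E x y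
adj-tabulate E x y =
  trans (cong (λ v → lookup v y) (Vec.lookup∘tabulate (λ x → tabulate (E x)) x)) (Vec.lookup∘tabulate (E x) y)

module _ {b n} (H : Adj b) (f : Vec (Fin n) b) where

  VertexOf : Fin n → Set
  VertexOf v = ∃ λ u → lookup f u ≡ v

  EdgeOf : Fin n → Fin n → Set
  EdgeOf x y = ∃ λ u → ∃ λ w → T (adj H u w) × lookup f u ≡ x × lookup f w ≡ y

  meets : Fin n → Fin b → Bool
  meets v u = lookup f u ==F v

  joins : Fin n → Fin n → Fin b → Fin b → Bool
  joins x y u w = adj H u w ∧ (lookup f u ==F x) ∧ (lookup f w ==F y)

  image-vertex⁻ : ∀ v → T (lookup (proj₁ (image H f)) v) → VertexOf v
  image-vertex⁻ v t =
    let u , eq = any-allFin⁻ (meets v) (subst T (Vec.lookup∘tabulate (λ v → any (meets v) (allFin b)) v) t)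
    in u , toWitness eq

  image-vertex⁺ : ∀ v → VertexOf v → T (lookup (proj₁ (image H f)) v)
  image-vertex⁺ v (u , eq) = subst T (sym (Vec.lookup∘tabulate (λ v → any (meets v) (allFin b)) v))
    (any-allFin⁺ (meets v) u (fromWitness {a? = lookup f u Fin.≟ v} eq))

  adj-image : ∀ x y → adj (proj₂ (image H f)) x y ≡ any (λ u → any (joins x y u) (allFin b)) (allFin b)
  adj-image = adj-tabulate (λ x y → any (λ u → any (joins x y u) (allFin b)) (allFin b))

  image-edge⁻ : ∀ x y → T (adj (proj₂ (image H f)) x y) → EdgeOf x y
  image-edge⁻ x y t =
    let u , t′ = any-allFin⁻ (λ u → any (joins x y u) (allFin b)) (subst T (adj-image x y) t)
        w , t″ = any-allFin⁻ (joins x y u) t′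
        a , p = to (T-∧ {adj H u w}) t″
        q , r = to (T-∧ {lookup f u ==F x}) p
    in u , w , a , toWitness q , toWitness r

  image-edge⁺ : ∀ x y → EdgeOf x y → T (adj (proj₂ (image H f)) x y)
  image-edge⁺ x y (u , w , a , p , q) = subst T (sym (adj-image x y))
    (any-allFin⁺ (λ u → any (joins x y u) (allFin b)) u (any-allFin⁺ (joins x y u) w
      (from (T-∧ {adj H u w}) (a , from (T-∧ {lookup f u ==F x})
        (fromWitness {a? = lookup f u Fin.≟ x} p , fromWitness {a? = lookup f w Fin.≟ y} q)))))

record SameImage {b n} (H : Adj b) (f f′ : Vec (Fin n) b) : Set where
  constructor sameImage
  field
    image-≡ : image H f ≡ image H f′

open SameImage

SameImage-sym : ∀ {b n} {H : Adj b} {f f′ : Vec (Fin n) b} → SameImage H f f′ → SameImage H f′ f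
SameImage-sym (sameImage eq) = sameImage (sym eq)

module _ {b n} {H : Adj b} {f f′ : Vec (Fin n) b} (s : SameImage H f f′) where

  same-vertex : ∀ v → VertexOf H f v → VertexOf H f′ v
  same-vertex v t = image-vertex⁻ H f′ v (subst (λ I → T (lookup (proj₁ I) v)) (image-≡ s) (image-vertex⁺ H f v t))

  same-edge : ∀ x y → EdgeOf H f x y → EdgeOf H f′ x y
  same-edge x y t = image-edge⁻ H f′ x y (subst (λ I → T (adj (proj₂ I) x y)) (image-≡ s) (image-edge⁺ H f x y t))

same-image : ∀ {b n} (H : Adj b) (f f′ : Vec (Fin n) b) →
  (∀ v → VertexOf H f v → VertexOf H f′ v) → (∀ v → VertexOf H f′ v → VertexOf H f v) →
  (∀ x y → EdgeOf H f x y → EdgeOf H f′ x y) → (∀ x y → EdgeOf H f′ x y → EdgeOf H f x y) →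
  SameImage H f f′
same-image H f f′ v⇒ v⇐ e⇒ e⇐ = sameImage (cong₂ _,_
  (vec-ext λ v → T⇔T⇒≡ (λ t → image-vertex⁺ H f′ v (v⇒ v (image-vertex⁻ H f v t)))
                       (λ t → image-vertex⁺ H f v (v⇐ v (image-vertex⁻ H f′ v t))))
  (vec-ext λ x → vec-ext λ y → T⇔T⇒≡ (λ t → image-edge⁺ H f′ x y (e⇒ x y (image-edge⁻ H f x y t)))
                                     (λ t → image-edge⁺ H f x y (e⇐ x y (image-edge⁻ H f′ x y t)))))

module Quotient {b} (H : Adj b) where

  idᵛ : Vec (Fin b) b
  idᵛ = tabulate Function.id

  lookup-idᵛ : ∀ u → lookup idᵛ u ≡ u
  lookup-idᵛ = Vec.lookup∘tabulate Function.id

  sameImageᵇ : ∀ {n} → Vec (Fin n) b → Vec (Fin n) b → Bool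
  sameImageᵇ f₀ f = ⌊ subgraphDec (image H f) (image H f₀) ⌋

  fibre : ∀ {n} → Adj n → Vec (Fin n) b → List (Vec (Fin n) b)
  fibre G f₀ = filterᵇ (sameImageᵇ f₀) (embeddings H G)

  ∈-fibre⁺ : ∀ {n} (G : Adj n) f₀ {f} → IsEmbedding H G f → SameImage H f f₀ → f ∈ fibre G f₀
  ∈-fibre⁺ G f₀ {f} emb (sameImage eq) = ∈-filterᵇ⁺ (sameImageᵇ f₀) (∈-embeddings⁺ H G emb)
    (fromWitness {a? = subgraphDec (image H f) (image H f₀)} eq)

  ∈-fibre⁻ : ∀ {n} (G : Adj n) f₀ {f} → f ∈ fibre G f₀ → IsEmbedding H G f × SameImage H f f₀
  ∈-fibre⁻ G f₀ {f} f∈ = let p , q = ∈-filterᵇ⁻ (sameImageᵇ f₀) {xs = embeddings H G} f∈ in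
    ∈-embeddings⁻ H G p , sameImage (toWitness {a? = subgraphDec (image H f) (image H f₀)} q)

  fibre-unique : ∀ {n} (G : Adj n) f₀ → Unique (fibre G f₀)
  fibre-unique G f₀ = filterᵇ-unique (sameImageᵇ f₀) (embeddings-unique H G)

  -- Taken as the fibre of the identity, so that the group of automorphisms and the fibre over a
  -- copy are objects of the same kind and can be matched by composition.
  automorphisms : List (Vec (Fin b) b)
  automorphisms = fibre H idᵛ

  0<automorphisms : 0 < length automorphisms
  0<automorphisms = ∈-length (∈-fibre⁺ H idᵛ {idᵛ} (embedding inj hom) (sameImage refl))
    where
    inj : ∀ u w → lookup idᵛ u ≡ lookup idᵛ w → u ≡ w
    inj u w eq = trans (sym (lookup-idᵛ u)) (trans eq (lookup-idᵛ w))
    hom : ∀ u w → T (adj H u w) → T (adj H (lookup idᵛ u) (lookup idᵛ w))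
    hom u w a = subst₂ (λ x y → T (adj H x y)) (sym (lookup-idᵛ u)) (sym (lookup-idᵛ w)) a

  module Fibre {n} (G : Adj n) {f₀ : Vec (Fin n) b} (emb₀ : IsEmbedding H G f₀) where

    f₀∘ : Vec (Fin b) b → Vec (Fin n) b
    f₀∘ σ = tabulate λ u → lookup f₀ (lookup σ u)

    lookup-f₀∘ : ∀ σ u → lookup (f₀∘ σ) u ≡ lookup f₀ (lookup σ u)
    lookup-f₀∘ σ = Vec.lookup∘tabulate (λ u → lookup f₀ (lookup σ u))

    f₀-injective : ∀ {u w} → lookup f₀ u ≡ lookup f₀ w → u ≡ w
    f₀-injective = injective emb₀ _ _

    f₀∘-injective : ∀ {σ τ} → f₀∘ σ ≡ f₀∘ τ → σ ≡ τ
    f₀∘-injective {σ} {τ} eq = vec-ext λ u → f₀-injective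
      (trans (sym (lookup-f₀∘ σ u)) (trans (cong (λ f → lookup f u) eq) (lookup-f₀∘ τ u)))

    image-f₀∘ : ∀ {σ} → SameImage H σ idᵛ → SameImage H (f₀∘ σ) f₀
    image-f₀∘ {σ} eq = same-image H (f₀∘ σ) f₀ v⇒ v⇐ e⇒ e⇐
      where
      v⇒ : ∀ v → VertexOf H (f₀∘ σ) v → VertexOf H f₀ v
      v⇒ v (u , p) = lookup σ u , trans (sym (lookup-f₀∘ σ u)) p
      v⇐ : ∀ v → VertexOf H f₀ v → VertexOf H (f₀∘ σ) v
      v⇐ v (u , p) = let u′ , σu′≡u = same-vertex (SameImage-sym eq) u (u , lookup-idᵛ u) in
        u′ , trans (lookup-f₀∘ σ u′) (trans (cong (lookup f₀) σu′≡u) p)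
      e⇒ : ∀ x y → EdgeOf H (f₀∘ σ) x y → EdgeOf H f₀ x y
      e⇒ x y (u , w , a , p , q) =
        let u′ , w′ , a′ , p′ , q′ = same-edge eq (lookup σ u) (lookup σ w) (u , w , a , refl , refl) in
        u′ , w′ , a′ ,
        trans (cong (lookup f₀) (trans (sym (lookup-idᵛ u′)) p′)) (trans (sym (lookup-f₀∘ σ u)) p) ,
        trans (cong (lookup f₀) (trans (sym (lookup-idᵛ w′)) q′)) (trans (sym (lookup-f₀∘ σ w)) q)
      e⇐ : ∀ x y → EdgeOf H f₀ x y → EdgeOf H (f₀∘ σ) x y
      e⇐ x y (u , w , a , p , q) =
        let u′ , w′ , a′ , p′ , q′ = same-edge (SameImage-sym eq) u w (u , w , a , lookup-idᵛ u , lookup-idᵛ w) in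
        u′ , w′ , a′ ,
        trans (lookup-f₀∘ σ u′) (trans (cong (lookup f₀) p′) p) ,
        trans (lookup-f₀∘ σ w′) (trans (cong (lookup f₀) q′) q)

    f₀∘-∈-fibre : ∀ {σ} → σ ∈ automorphisms → f₀∘ σ ∈ fibre G f₀
    f₀∘-∈-fibre {σ} σ∈ = ∈-fibre⁺ G f₀ (embedding inj hom) (image-f₀∘ (proj₂ σ∈²))
      where
      σ∈² = ∈-fibre⁻ H idᵛ σ∈
      inj : ∀ u w → lookup (f₀∘ σ) u ≡ lookup (f₀∘ σ) w → u ≡ w
      inj u w eq = injective (proj₁ σ∈²) u w
        (f₀-injective (trans (sym (lookup-f₀∘ σ u)) (trans eq (lookup-f₀∘ σ w))))
      hom : ∀ u w → T (adj H u w) → T (adj G (lookup (f₀∘ σ) u) (lookup (f₀∘ σ) w))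
      hom u w a = subst₂ (λ x y → T (adj G x y)) (sym (lookup-f₀∘ σ u)) (sym (lookup-f₀∘ σ w))
        (edges emb₀ _ _ (edges (proj₁ σ∈²) u w a))

    module _ {f : Vec (Fin n) b} (emb : IsEmbedding H G f) (eq : SameImage H f f₀) where

      σ : Vec (Fin b) b
      σ = tabulate λ u → proj₁ (same-vertex eq (lookup f u) (u , refl))

      f₀σ : ∀ u → lookup f₀ (lookup σ u) ≡ lookup f u
      f₀σ u = trans (cong (lookup f₀) (Vec.lookup∘tabulate (λ u → proj₁ (same-vertex eq (lookup f u) (u , refl))) u))
        (proj₂ (same-vertex eq (lookup f u) (u , refl)))

      f₀∘σ≡f : f₀∘ σ ≡ f
      f₀∘σ≡f = vec-ext λ u → trans (lookup-f₀∘ σ u) (f₀σ u)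

      -- An edge of the copy covered by `f` is also the `f₀`-image of some edge of `H`; injectivity
      -- of `f₀` identifies its ends with `σ u` and `σ w`.
      σ-hom : ∀ u w → T (adj H u w) → T (adj H (lookup σ u) (lookup σ w))
      σ-hom u w a =
        let u′ , w′ , a′ , p , q = same-edge eq (lookup f u) (lookup f w) (u , w , a , refl , refl) in
        subst₂ (λ x y → T (adj H x y))
          (f₀-injective (trans p (sym (f₀σ u)))) (f₀-injective (trans q (sym (f₀σ w)))) a′

      σ-embedding : IsEmbedding H H σ
      σ-embedding = embedding
        (λ u w eq → injective emb u w (trans (sym (f₀σ u)) (trans (cong (lookup f₀) eq) (f₀σ w)))) σ-hom

      image-σ : SameImage H σ idᵛ
      image-σ = same-image H σ idᵛ (λ v _ → v , lookup-idᵛ v) v⇐ e⇒ e⇐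
        where
        v⇐ : ∀ v → VertexOf H idᵛ v → VertexOf H σ v
        v⇐ v _ = let u , p = same-vertex (SameImage-sym eq) (lookup f₀ v) (v , refl) in
          u , f₀-injective (trans (f₀σ u) p)
        e⇒ : ∀ x y → EdgeOf H σ x y → EdgeOf H idᵛ x y
        e⇒ x y (u , w , a , p , q) =
          _ , _ , σ-hom u w a , trans (lookup-idᵛ (lookup σ u)) p , trans (lookup-idᵛ (lookup σ w)) q
        e⇐ : ∀ x y → EdgeOf H idᵛ x y → EdgeOf H σ x y
        e⇐ x y (u , w , a , p , q) =
          let u′ , w′ , a′ , p′ , q′ = same-edge (SameImage-sym eq) (lookup f₀ u) (lookup f₀ w) (u , w , a , refl , refl) in
          u′ , w′ , a′ ,
          trans (f₀-injective (trans (f₀σ u′) p′)) (trans (sym (lookup-idᵛ u)) p) ,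
          trans (f₀-injective (trans (f₀σ w′) q′)) (trans (sym (lookup-idᵛ w)) q)

    -- Composition with `f₀` maps the automorphisms bijectively onto the fibre: it is injective
    -- because `f₀` is, and any `f` with the same image factors as `f₀∘ σ` with `σ` an automorphism.
    length-fibre : length (fibre G f₀) ≡ length automorphisms
    length-fibre = ≤-antisym
      (≤-trans (unique-⊆⇒length≤ (fibre-unique G f₀) sub)
               (≤-reflexive (List.length-map f₀∘ automorphisms)))
      (≤-trans (≤-reflexive (sym (List.length-map f₀∘ automorphisms)))
               (unique-⊆⇒length≤ (Unique.map⁺ f₀∘-injective (fibre-unique H idᵛ)) sup))
      where
      sub : fibre G f₀ ⊆ map f₀∘ automorphisms
      sub f∈ = let emb , eq = ∈-fibre⁻ G f₀ f∈ in
        subst (_∈ map f₀∘ automorphisms) (f₀∘σ≡f emb eq)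
          (∈-map⁺ f₀∘ (∈-fibre⁺ H idᵛ (σ-embedding emb eq) (image-σ emb eq)))
      sup : map f₀∘ automorphisms ⊆ fibre G f₀
      sup f∈ = let σ , σ∈ , eq = ∈-map⁻ f₀∘ f∈ in subst (_∈ fibre G f₀) (sym eq) (f₀∘-∈-fibre σ∈)

  -- Copies are the distinct values of `image`, and all fibres have the same size. The multiplier
  -- depends on `H` alone, so it cancels when two graphs `G` are compared.
  N*automorphisms : ∀ {n} (G : Adj n) → N H G * length automorphisms ≡ length (embeddings H G)
  N*automorphisms {n} G = sym (trans
    (length-fibres subgraphDec (image H) (deduplicate-! subgraphDec (map (image H) (embeddings H G)))
      (embeddings H G) (λ f∈ → ∈-deduplicate⁺ subgraphDec (∈-map⁺ (image H) f∈)))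
    (sumᴸ-const (λ S → count (λ f → ⌊ subgraphDec (image H f) S ⌋) (embeddings H G))
      (length automorphisms) (copies H G) fibre-size))
    where
    open import Data.List.Relation.Unary.Unique.DecPropositional.Properties using (deduplicate-!)
    fibre-size : ∀ {S} → S ∈ copies H G →
      count (λ f → ⌊ subgraphDec (image H f) S ⌋) (embeddings H G) ≡ length automorphisms
    fibre-size S∈ =
      let f₀ , f₀∈ , eq = ∈-map⁻ (image H) (∈-deduplicate⁻ subgraphDec (map (image H) (embeddings H G)) S∈) in
      subst (λ S → count (λ f → ⌊ subgraphDec (image H f) S ⌋) (embeddings H G) ≡ length automorphisms)
        (sym eq) (Fibre.length-fibre G (∈-embeddings⁻ H G f₀∈))

-- Degrees in bipartite graphs

<ᵇ-true : ∀ {a b} → a < b → (a <ᵇ b) ≡ true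
<ᵇ-true a<b = to T-≡ (<⇒<ᵇ a<b)

<ᵇ-false : ∀ {a b} → b ≤ a → (a <ᵇ b) ≡ false
<ᵇ-false {a} {b} b≤a with a <ᵇ b in eq
... | false = refl
... | true = contradiction b≤a (<⇒≱ (<ᵇ⇒< a b (from T-≡ eq)))

==B-refl : ∀ a → (a ==B a) ≡ true
==B-refl false = refl
==B-refl true = refl

two-colours : ∀ {a b c : Bool} → a ≢ b → b ≢ c → a ≡ c
two-colours {false} {false} a≢b _ = contradiction refl a≢b
two-colours {false} {true} {false} _ _ = refl
two-colours {false} {true} {true} _ b≢c = contradiction refl b≢c
two-colours {true} {true} a≢b _ = contradiction refl a≢b
two-colours {true} {false} {true} _ _ = refl
two-colours {true} {false} {false} _ b≢c = contradiction refl b≢c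

double-cancel : ∀ {a b} → a + a ≤ b + b → a ≤ b
double-cancel {a} {b} le with a ≤? b
... | yes a≤b = a≤b
... | no a≰b = contradiction le (<⇒≱ (+-mono-< (≰⇒> a≰b) (≰⇒> a≰b)))

-- Convexity of the power: of two pairs with the same sum, the more spread one has the larger power
-- sum. The induction multiplies the previous case by `t + h`; what is left over is settled by
-- monotonicity.
rearrangement-^ : ∀ p t h k → (t + h) ^ p + (t + k) ^ p ≤ t ^ p + (t + k + h) ^ p
rearrangement-^ zero t h k = ≤-refl
-- Adding `h * Z` turns `t + k` into `t + h + k` in front of `Z`, so that `t + h` becomes a common
-- factor of `Y` and `Z` without any subtraction.
rearrangement-^ (suc p) t h k = +-cancelʳ-≤ (h * Z) _ _ (begin
  (t + h) * Y + (t + k) * Z + h * Z       ≡⟨ eq₁ t h k Y Z ⟩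
  (t + h) * (Y + Z) + k * Z               ≤⟨ +-monoˡ-≤ (k * Z) (*-monoʳ-≤ (t + h) (rearrangement-^ p t h k)) ⟩
  (t + h) * (X + W) + k * Z               ≡⟨ eq₂ t h k X W Z ⟩
  t * X + (t + h) * W + (h * X + k * Z)   ≤⟨ +-monoʳ-≤ (t * X + (t + h) * W)
                                               (+-mono-≤ (*-monoʳ-≤ h X≤Z) (*-monoʳ-≤ k Z≤W)) ⟩
  t * X + (t + h) * W + (h * Z + k * W)   ≡⟨ eq₃ t h k X W Z ⟩
  t * X + (t + k + h) * W + h * Z         ∎)
  where
  X = t ^ p
  Y = (t + h) ^ p
  Z = (t + k) ^ p
  W = (t + k + h) ^ p
  X≤Z : X ≤ Z
  X≤Z = ^-monoˡ-≤ p (m≤m+n t k)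
  Z≤W : Z ≤ W
  Z≤W = ^-monoˡ-≤ p (m≤m+n (t + k) h)
  eq₁ : ∀ t h k Y Z → (t + h) * Y + (t + k) * Z + h * Z ≡ (t + h) * (Y + Z) + k * Z
  eq₁ = solve-∀
  eq₂ : ∀ t h k X W Z → (t + h) * (X + W) + k * Z ≡ t * X + (t + h) * W + (h * X + k * Z)
  eq₂ = solve-∀
  eq₃ : ∀ t h k X W Z → t * X + (t + h) * W + (h * Z + k * W) ≡ t * X + (t + k + h) * W + h * Z
  eq₃ = solve-∀

-- If one of the numbers is at most `t`, compare termwise. Otherwise spread the two apart with their
-- sum fixed until one equals `t`; the other is then still at most `s`.
^-sum-max : ∀ p {a b s t} → a ≤ s → b ≤ s → a + b ≤ s + t → a ^ p + b ^ p ≤ s ^ p + t ^ p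
^-sum-max p {a} {b} {s} {t} a≤s b≤s a+b≤ with ≤-total b t | ≤-total a t
... | inj₁ b≤t | _ = +-mono-≤ (^-monoˡ-≤ p a≤s) (^-monoˡ-≤ p b≤t)
... | inj₂ _ | inj₁ a≤t = ≤-trans (≤-reflexive (+-comm (a ^ p) (b ^ p)))
  (+-mono-≤ (^-monoˡ-≤ p b≤s) (^-monoˡ-≤ p a≤t))
... | inj₂ t≤b | inj₂ t≤a = begin
  a ^ p + b ^ p                   ≡⟨ cong₂ (λ a b → a ^ p + b ^ p) (m+[n∸m]≡n t≤a) (m+[n∸m]≡n t≤b) ⟨
  (t + h) ^ p + (t + k) ^ p       ≤⟨ rearrangement-^ p t h k ⟩
  t ^ p + (t + k + h) ^ p         ≤⟨ +-monoʳ-≤ (t ^ p) (^-monoˡ-≤ p t+k+h≤s) ⟩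
  t ^ p + s ^ p                   ≡⟨ +-comm (t ^ p) (s ^ p) ⟩
  s ^ p + t ^ p                   ∎
  where
  h = a ∸ t
  k = b ∸ t
  t+k+h≤s : t + k + h ≤ s
  t+k+h≤s = +-cancelʳ-≤ t _ _ (begin
    t + k + h + t     ≡⟨ +-assoc (t + k) h t ⟩
    t + k + (h + t)   ≡⟨ cong₂ _+_ (m+[n∸m]≡n t≤b) (m∸n+n≡m t≤a) ⟩
    b + a             ≡⟨ +-comm b a ⟩
    a + b             ≤⟨ a+b≤ ⟩
    s + t             ∎)

∑∑-distrib-+ : (f g : Fin m → Fin n → ℕ) →
  ∑ (λ i → ∑ (f i)) + ∑ (λ i → ∑ (g i)) ≡ ∑ (λ i → ∑ (λ j → f i j + g i j))
∑∑-distrib-+ f g = sym (trans (∑-cong λ i → ∑-distrib-+ (f i) (g i)) (∑-distrib-+ (∑ ∘ f) (∑ ∘ g)))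

∑∑-cong : {f g : Fin m → Fin n → ℕ} → (∀ i j → f i j ≡ g i j) → ∑ (λ i → ∑ (f i)) ≡ ∑ (λ i → ∑ (g i))
∑∑-cong eq = ∑-cong λ i → ∑-cong (eq i)

∑∑-mono : {f g : Fin m → Fin n → ℕ} → (∀ i j → f i j ≤ g i j) → ∑ (λ i → ∑ (f i)) ≤ ∑ (λ i → ∑ (g i))
∑∑-mono le = ∑-mono λ i → ∑-mono (le i)

∑∑-*ʳ : (f : Fin m → Fin n → ℕ) → ∀ c → ∑ (λ i → ∑ (f i)) * c ≡ ∑ (λ i → ∑ (λ j → f i j * c))
∑∑-*ʳ f c = trans (*-distribʳ-sum c (∑ ∘ f)) (∑-cong λ i → *-distribʳ-sum c (f i))

∑∑-* : (f : Vector ℕ m) (g : Vector ℕ n) → ∑ f * ∑ g ≡ ∑ (λ i → ∑ (λ j → f i * g j))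
∑∑-* f g = trans (*-distribʳ-sum (∑ g) f) (∑-cong λ i → *-distribˡ-sum (f i) g)

edgeCount≡∑∑ : (G : Adj n) → edgeCount G ≡ ∑ (λ i → ∑ (λ j → 𝟙 (toℕ i <ᵇ toℕ j) * 𝟙 (adj G i j)))
edgeCount≡∑∑ {n} G = trans (count-concatMap-allFin p (λ i → concatMap (cell i) (allFin n)))
  (∑-cong λ i → trans (count-concatMap-allFin p (cell i))
    (∑-cong λ j → entry (toℕ i <ᵇ toℕ j) i j))
  where
  p : Fin n × Fin n → Bool
  p (i , j) = adj G i j
  cell : Fin n → Fin n → List (Fin n × Fin n)
  cell i j = if toℕ i <ᵇ toℕ j then (i , j) ∷ [] else []
  entry : ∀ b i j → count p (if b then (i , j) ∷ [] else []) ≡ 𝟙 b * 𝟙 (adj G i j)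
  entry false i j = refl
  entry true i j = trans (count-∷ p (i , j) []) refl

degree : Adj n → Fin n → ℕ
degree G v = ∑ (λ w → 𝟙 (adj G v w))

handshake : (G : Adj n) → SimpleGraph G → ∑ (degree G) ≡ edgeCount G + edgeCount G
handshake {n} G (symm , irr) = begin-equality
  ∑ (degree G)                                       ≡⟨ ∑∑-cong split ⟩
  ∑ (λ i → ∑ (λ j → up i j + up j i))                ≡⟨ ∑∑-distrib-+ up (λ i j → up j i) ⟨
  ∑ (λ i → ∑ (up i)) + ∑ (λ i → ∑ (λ j → up j i))    ≡⟨ cong (∑ (λ i → ∑ (up i)) +_) (∑-comm (λ i j → up j i)) ⟩
  ∑ (λ i → ∑ (up i)) + ∑ (λ i → ∑ (up i))            ≡⟨ cong₂ _+_ (edgeCount≡∑∑ G) (edgeCount≡∑∑ G) ⟨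
  edgeCount G + edgeCount G                          ∎
  where
  up : Fin n → Fin n → ℕ
  up i j = 𝟙 (toℕ i <ᵇ toℕ j) * 𝟙 (adj G i j)
  split : ∀ i j → 𝟙 (adj G i j) ≡ up i j + up j i
  split i j with <-cmp (toℕ i) (toℕ j)
  ... | tri< lt _ _ rewrite <ᵇ-true lt | <ᵇ-false (<⇒≤ lt) = sym (trans (+-identityʳ _) (+-identityʳ _))
  ... | tri> _ _ gt rewrite <ᵇ-true gt | <ᵇ-false (<⇒≤ gt) | symm i j = sym (+-identityʳ _)
  ... | tri≈ _ eq _ with Fin.toℕ-injective eq
  ...   | refl rewrite irr i = sym (cong₂ _+_ (*-zeroʳ (𝟙 (toℕ i <ᵇ toℕ i))) (*-zeroʳ (𝟙 (toℕ i <ᵇ toℕ i))))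

Proper : Adj n → (Fin n → Bool) → Set
Proper G g = ∀ i j → T (adj G i j) → g i ≢ g j

module BipartiteGraph {n} (G : Adj n) (simple : SimpleGraph G) (g : Fin n → Bool) (proper : Proper G g) where

  private
    e = edgeCount G
    d = degree G

  inSide : Bool → Fin n → Bool
  inSide s x = g x ==B s

  oriented : Bool → Fin n → Fin n → Bool
  oriented s x y = adj G x y ∧ inSide s x

  side : Bool → ℕ
  side s = ∑ (𝟙 ∘ inSide s)

  oriented-reverse : ∀ s x y → 𝟙 (oriented s x y) + 𝟙 (oriented s y x) ≡ 𝟙 (adj G x y)
  oriented-reverse s x y rewrite proj₁ simple y x with adj G x y in eq
  ... | false = refl
  ... | true = one (g x) (g y) s (proper x y (from T-≡ eq))
    where
    one : ∀ a b s → a ≢ b → 𝟙 (a ==B s) + 𝟙 (b ==B s) ≡ 1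
    one false false s a≢b = contradiction refl a≢b
    one true true s a≢b = contradiction refl a≢b
    one false true false _ = refl
    one false true true _ = refl
    one true false false _ = refl
    one true false true _ = refl

  -- Exactly one of the two orientations of an edge starts on side `s`. Exchanging the summation
  -- variables does not change the double sum, so twice the sum is the degree sum.
  oriented-total : ∀ s → ∑ (λ x → ∑ (λ y → 𝟙 (oriented s x y))) ≡ e
  oriented-total s = ≤-antisym (double-cancel (≤-reflexive twice)) (double-cancel (≤-reflexive (sym twice)))
    where
    E = ∑ (λ x → ∑ (λ y → 𝟙 (oriented s x y)))
    twice : E + E ≡ e + e
    twice = begin-equality
      E + E                                                             ≡⟨ cong (E +_) (∑-comm (λ x y → 𝟙 (oriented s x y))) ⟩
      E + ∑ (λ x → ∑ (λ y → 𝟙 (oriented s y x)))                        ≡⟨ ∑∑-distrib-+ (λ x y → 𝟙 (oriented s x y)) (λ x y → 𝟙 (oriented s y x)) ⟩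
      ∑ (λ x → ∑ (λ y → 𝟙 (oriented s x y) + 𝟙 (oriented s y x)))       ≡⟨ ∑∑-cong (oriented-reverse s) ⟩
      ∑ d                                                               ≡⟨ handshake G simple ⟩
      e + e                                                             ∎

  opposite : ∀ {x y} → T (adj G x y) → inSide (not (g x)) y ≡ true
  opposite {x} {y} a = lem (g x) (g y) (proper x y a)
    where
    lem : ∀ a b → a ≢ b → (b ==B not a) ≡ true
    lem false false a≢b = contradiction refl a≢b
    lem false true _ = refl
    lem true false _ = refl
    lem true true a≢b = contradiction refl a≢b

  side-+ : ∀ s → side s + side (not s) ≡ n
  side-+ s = trans (sym (∑-distrib-+ (𝟙 ∘ inSide s) (𝟙 ∘ inSide (not s))))
    (trans (∑-cong (λ x → lem (g x) s)) (trans (∑-const n 1) (*-identityʳ n)))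
    where
    lem : ∀ a s → 𝟙 (a ==B s) + 𝟙 (a ==B not s) ≡ 1
    lem false false = refl
    lem false true = refl
    lem true false = refl
    lem true true = refl

  e≤side*side : ∀ s → e ≤ side s * side (not s)
  e≤side*side s = begin
    e                                                            ≡⟨ oriented-total s ⟨
    ∑ (λ x → ∑ (λ y → 𝟙 (oriented s x y)))                       ≤⟨ ∑∑-mono bound ⟩
    ∑ (λ x → ∑ (λ y → 𝟙 (inSide s x) * 𝟙 (inSide (not s) y)))    ≡⟨ ∑∑-* (𝟙 ∘ inSide s) (𝟙 ∘ inSide (not s)) ⟨
    side s * side (not s)                                        ∎
    where
    bound : ∀ x y → 𝟙 (oriented s x y) ≤ 𝟙 (inSide s x) * 𝟙 (inSide (not s) y)
    bound x y with adj G x y in eq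
    ... | false = z≤n
    ... | true with g x Bool.≟ s
    ...   | no _ = z≤n
    ...   | yes refl rewrite opposite (from T-≡ eq) = ≤-refl

  degree≤side : ∀ v → d v ≤ side (not (g v))
  degree≤side v = ∑-mono bound
    where
    bound : ∀ w → 𝟙 (adj G v w) ≤ 𝟙 (inSide (not (g v)) w)
    bound w with adj G v w in eq
    ... | false = z≤n
    ... | true rewrite opposite (from T-≡ eq) = ≤-refl

  -- A common neighbour would put both ends of the edge on the same side, so the two neighbourhoods
  -- are disjoint.
  edge-degrees : ∀ {x y} → T (adj G x y) → d x + d y ≤ n
  edge-degrees {x} {y} a = begin
    d x + d y                                    ≡⟨ ∑-distrib-+ (𝟙 ∘ adj G x) (𝟙 ∘ adj G y) ⟨
    ∑ (λ w → 𝟙 (adj G x w) + 𝟙 (adj G y w))      ≤⟨ ∑-mono bound ⟩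
    ∑ {n} (λ _ → 1)                              ≡⟨ trans (∑-const n 1) (*-identityʳ n) ⟩
    n                                            ∎
    where
    bound : ∀ w → 𝟙 (adj G x w) + 𝟙 (adj G y w) ≤ 1
    bound w with adj G x w in eq | adj G y w in eq′
    ... | false | b = 𝟙≤1 b
    ... | true | false = ≤-refl
    ... | true | true = contradiction
      (two-colours (proper x w (from T-≡ eq)) (proper y w (from T-≡ eq′) ∘ sym)) (proper x y a)

  module _ (t : ℕ) (minimal : ∀ i → i < t → i * (n ∸ i) < e) where

    -- A side with `i` vertices leaves room for at most `i * (n ∸ i)` edges, which is less than `e`
    -- when `i < t`.
    t≤side : ∀ s → t ≤ side s
    t≤side s with t ≤? side s
    ... | yes t≤ = t≤
    ... | no t≰ = contradiction (minimal (side s) (≰⇒> t≰)) (≤⇒≯ (begin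
      e                        ≤⟨ e≤side*side s ⟩
      side s * side (not s)    ≡⟨ cong (side s *_) (trans (sym (m+n∸m≡n (side s) _)) (cong (_∸ side s) (side-+ s))) ⟩
      side s * (n ∸ side s)    ∎))

    degree≤n∸t : ∀ v → d v ≤ n ∸ t
    degree≤n∸t v = begin
      d v                                            ≤⟨ degree≤side v ⟩
      side (not (g v))                               ≡⟨ m+n∸m≡n (side (g v)) _ ⟨
      side (g v) + side (not (g v)) ∸ side (g v)     ≡⟨ cong (_∸ side (g v)) (side-+ (g v)) ⟩
      n ∸ side (g v)                                 ≤⟨ ∸-monoʳ-≤ n (t≤side (g v)) ⟩
      n ∸ t                                          ∎

  degree-power-sum : ∀ p {s t} → (∀ v → d v ≤ s) → n ≤ s + t →
    ∑ (λ v → d v ^ suc p) ≤ e * (s ^ p + t ^ p)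
  degree-power-sum p {s} {t} d≤s n≤s+t = double-cancel (begin
    -- One factor of the degree is spent on a sum over neighbours. The result is written once with
    -- the power at the tail and once with it at the head, so each of the `e + e` ordered adjacent
    -- pairs carries both powers.
    ∑ (λ v → d v ^ suc p) + ∑ (λ v → d v ^ suc p)   ≡⟨ cong₂ _+_ tails heads ⟩
    ∑ (λ v → ∑ (λ w → 𝟙 (adj G v w) * d v ^ p)) + ∑ (λ v → ∑ (λ w → 𝟙 (adj G v w) * d w ^ p))
      ≡⟨ ∑∑-distrib-+ (λ v w → 𝟙 (adj G v w) * d v ^ p) (λ v w → 𝟙 (adj G v w) * d w ^ p) ⟩
    ∑ (λ v → ∑ (λ w → 𝟙 (adj G v w) * d v ^ p + 𝟙 (adj G v w) * d w ^ p))
      ≤⟨ ∑∑-mono bound ⟩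
    ∑ (λ v → ∑ (λ w → 𝟙 (adj G v w) * c))           ≡⟨ ∑∑-*ʳ (λ v w → 𝟙 (adj G v w)) c ⟨
    ∑ d * c                                         ≡⟨ cong (_* c) (handshake G simple) ⟩
    (e + e) * c                                     ≡⟨ *-distribʳ-+ c e e ⟩
    e * c + e * c                                   ∎)
    where
    c = s ^ p + t ^ p
    tails : ∑ (λ v → d v ^ suc p) ≡ ∑ (λ v → ∑ (λ w → 𝟙 (adj G v w) * d v ^ p))
    tails = ∑-cong λ v → *-distribʳ-sum (d v ^ p) (λ w → 𝟙 (adj G v w))
    heads : ∑ (λ v → d v ^ suc p) ≡ ∑ (λ v → ∑ (λ w → 𝟙 (adj G v w) * d w ^ p))
    heads = trans tails (trans (∑-comm (λ v w → 𝟙 (adj G v w) * d v ^ p))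
      (∑∑-cong λ w v → cong (λ b → 𝟙 b * d v ^ p) (proj₁ simple v w)))
    bound : ∀ v w → 𝟙 (adj G v w) * d v ^ p + 𝟙 (adj G v w) * d w ^ p ≤ 𝟙 (adj G v w) * c
    bound v w with adj G v w in eq
    ... | false = z≤n
    ... | true = begin
      1 * d v ^ p + 1 * d w ^ p   ≡⟨ cong₂ _+_ (*-identityˡ (d v ^ p)) (*-identityˡ (d w ^ p)) ⟩
      d v ^ p + d w ^ p           ≤⟨ ^-sum-max p (d≤s v) (d≤s w) (≤-trans (edge-degrees (from T-≡ eq)) n≤s+t) ⟩
      c                           ≡⟨ *-identityˡ c ⟨
      1 * c                       ∎

^-distribʳ-* : ∀ k x y → (x * y) ^ k ≡ x ^ k * y ^ k
^-distribʳ-* zero x y = refl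
^-distribʳ-* (suc k) x y = trans (cong (x * y *_) (^-distribʳ-* k x y)) (interchange x y (x ^ k) (y ^ k))
  where
  interchange : ∀ a b c d → a * b * (c * d) ≡ a * c * (b * d)
  interchange = solve-∀

-- Embeddings with a prescribed pattern of sides

-- The form in which a proper star and a bare matching are treated alike. The leaf makes the number
-- of leaves positive, so that the degree sum has an exponent `suc p` as in `degree-power-sum`.
record StarCover {b} (B : Adj b) : Set where
  field
    inStar : Fin b → Bool
    partner : Fin b → Fin b
    centre leaf : Fin b
    centre∈ : inStar centre ≡ true
    leaf∈ : inStar leaf ≡ true
    leaf≢centre : leaf ≢ centre
    spoke : ∀ w → inStar w ≡ true → w ≢ centre → T (adj B centre w)
    partner∉ : ∀ v → inStar v ≡ false → inStar (partner v) ≡ false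
    partner-involutive : ∀ v → inStar v ≡ false → partner (partner v) ≡ v
    partner-adj : ∀ v → inStar v ≡ false → T (adj B v (partner v))

==F-true : {i j : Fin n} → i ≡ j → (i ==F j) ≡ true
==F-true {i = i} {j} i≡j with i Fin.≟ j
... | yes _ = refl
... | no i≢j = contradiction i≡j i≢j

==F-false : {i j : Fin n} → i ≢ j → (i ==F j) ≡ false
==F-false {i = i} {j} i≢j with i Fin.≟ j
... | yes i≡j = contradiction i≡j i≢j
... | no _ = refl

vec-≟ : DecidableEquality (Vec Bool n)
vec-≟ = Vec.≡-dec Bool._≟_

module Pattern {b} (B : Adj b) (cover : StarCover B) where

  open StarCover cover

  -- Records which vertices are mapped to the same side as the star centre.
  pattern-of : ∀ {n} → (Fin n → Bool) → Vec (Fin n) b → Vec Bool b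
  pattern-of g f = tabulate λ u → g (lookup f u) ==B g (lookup f centre)

  withPattern : ∀ {n} → Adj n → (Fin n → Bool) → Vec Bool b → List (Vec (Fin n) b)
  withPattern G g c = filterᵇ (λ f → ⌊ vec-≟ (pattern-of g f) c ⌋) (embeddings B G)

  length-embeddings : ∀ {n} (G : Adj n) g →
    length (embeddings B G) ≡ sumᴸ (map (λ c → length (withPattern G g c)) (vecs bools b))
  length-embeddings G g = length-fibres vec-≟ (pattern-of g) (vecs-unique bools-unique b) (embeddings B G) (λ _ → ∈-vecs ∈-bools _)

  withPattern-unique : ∀ {n} (G : Adj n) g c → Unique (withPattern G g c)
  withPattern-unique G g c = filterᵇ-unique (λ f → ⌊ vec-≟ (pattern-of g f) c ⌋) (embeddings-unique B G)

  ∈-withPattern⁻ : ∀ {n} (G : Adj n) g c {f} → f ∈ withPattern G g c →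
    IsEmbedding B G f × (∀ u → lookup c u ≡ (g (lookup f u) ==B g (lookup f centre)))
  ∈-withPattern⁻ G g c {f} f∈ =
    let p , q = ∈-filterᵇ⁻ (λ f → ⌊ vec-≟ (pattern-of g f) c ⌋) {xs = embeddings B G} f∈ in
    ∈-embeddings⁻ B G p ,
    λ u → trans (cong (λ c → lookup c u) (sym (toWitness {a? = vec-≟ (pattern-of g f) c} q)))
                (Vec.lookup∘tabulate (λ u → g (lookup f u) ==B g (lookup f centre)) u)

  ∈-withPattern⁺ : ∀ {n} (G : Adj n) g c {f} → IsEmbedding B G f →
    (∀ u → lookup c u ≡ (g (lookup f u) ==B g (lookup f centre))) → f ∈ withPattern G g c
  ∈-withPattern⁺ G g c {f} emb eq =
    ∈-filterᵇ⁺ (λ f → ⌊ vec-≟ (pattern-of g f) c ⌋) (∈-embeddings⁺ B G emb)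
      (fromWitness {a? = vec-≟ (pattern-of g f) c} (vec-ext λ u →
        trans (Vec.lookup∘tabulate (λ u → g (lookup f u) ==B g (lookup f centre)) u) (sym (eq u))))

  -- The proper two-colourings of `B`, normalised at the centre: the classes that can be inhabited.
  record IsPattern (c : Vec Bool b) : Set where
    constructor isPattern
    field
      centre-colour : lookup c centre ≡ true
      bichromatic : ∀ u w → T (adj B u w) → lookup c u ≢ lookup c w

  withPattern⇒IsPattern : ∀ {n} {G : Adj n} {g} → Proper G g → ∀ {c f} → f ∈ withPattern G g c → IsPattern c
  withPattern⇒IsPattern {G = G} {g} proper {c} {f} f∈ = isPattern
    (trans (col centre) (==B-refl (g (lookup f centre))))
    (λ u w a eq → proper _ _ (IsEmbedding.edges emb u w a)
      (==B-cancel _ _ (g (lookup f centre)) (trans (sym (col u)) (trans eq (col w)))))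
    where
    emb = proj₁ (∈-withPattern⁻ G g c f∈)
    col = proj₂ (∈-withPattern⁻ G g c f∈)
    ==B-cancel : ∀ x y s → (x ==B s) ≡ (y ==B s) → x ≡ y
    ==B-cancel false false s _ = refl
    ==B-cancel true true s _ = refl
    ==B-cancel false true false ()
    ==B-cancel false true true ()
    ==B-cancel true false false ()
    ==B-cancel true false true ()

  module _ {c : Vec Bool b} (isPat : IsPattern c) where

    open IsPattern isPat

    col : Fin b → Bool
    col = lookup c

    isLeaf matchedTrue matchedFalse : Fin b → Bool
    isLeaf u = inStar u ∧ not (centre ==F u)
    matchedTrue u = not (inStar u) ∧ col u
    matchedFalse u = not (inStar u) ∧ not (col u)

    leaves matches : ℕ
    leaves = ∑ (𝟙 ∘ isLeaf)
    matches = ∑ (𝟙 ∘ matchedTrue)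

    leaf-colour : ∀ {u} → inStar u ≡ true → u ≢ centre → col u ≡ false
    leaf-colour {u} u∈ u≢z with col u in eq
    ... | false = refl
    ... | true = contradiction (trans centre-colour (sym eq)) (bichromatic centre u (spoke u u∈ u≢z))

    partner-colour : ∀ {u} → inStar u ≡ false → col (partner u) ≡ not (col u)
    partner-colour {u} u∉ = ¬-not (bichromatic u (partner u) (partner-adj u u∉) ∘ sym)

    0<leaves : 0 < leaves
    0<leaves = ≤-trans (≤-reflexive (sym (cong 𝟙 is))) (term≤∑ (𝟙 ∘ isLeaf) leaf)
      where
      is : isLeaf leaf ≡ true
      is rewrite leaf∈ | ==F-false (leaf≢centre ∘ sym) = refl

    -- `partner` is controlled only off the star; extended by the identity it becomes an involution
    -- of all vertices, along which a sum can be permuted.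
    mate : Fin b → Fin b
    mate u = if inStar u then u else partner u

    mate-involutive : ∀ u → mate (mate u) ≡ u
    mate-involutive u with inStar u in eq
    ... | true rewrite eq = refl
    ... | false rewrite partner∉ u eq = partner-involutive u eq

    -- A matching edge has one end of each colour, so `mate` exchanges the two kinds of matched
    -- vertices.
    matchedFalse-total : ∑ (𝟙 ∘ matchedFalse) ≡ matches
    matchedFalse-total = trans (sum-permute (𝟙 ∘ matchedFalse) (permutation mate mate mate-involutive mate-involutive))
      (∑-cong λ u → cong 𝟙 (swap u))
      where
      swap : ∀ u → matchedFalse (mate u) ≡ matchedTrue u
      swap u with inStar u in eq
      ... | true rewrite eq = refl
      ... | false rewrite partner∉ u eq | partner-colour eq with col u
      ...   | false = refl
      ...   | true = refl

    col-total : ∑ (𝟙 ∘ col) ≡ 1 + matches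
    col-total = trans (∑-cong split) (trans (∑-distrib-+ (λ u → 𝟙 (centre ==F u)) (𝟙 ∘ matchedTrue))
      (cong (_+ matches) (∑-𝟙-≟ centre)))
      where
      split : ∀ u → 𝟙 (col u) ≡ 𝟙 (centre ==F u) + 𝟙 (matchedTrue u)
      split u with centre Fin.≟ u
      ... | yes refl rewrite centre∈ | centre-colour = refl
      ... | no z≢u with inStar u in eq
      ...   | true rewrite leaf-colour eq (z≢u ∘ sym) = refl
      ...   | false = refl

    not-col-total : ∑ (𝟙 ∘ not ∘ col) ≡ matches + leaves
    not-col-total = trans (∑-cong split) (trans (∑-distrib-+ (𝟙 ∘ matchedFalse) (𝟙 ∘ isLeaf))
      (cong (_+ leaves) matchedFalse-total))
      where
      split : ∀ u → 𝟙 (not (col u)) ≡ 𝟙 (matchedFalse u) + 𝟙 (isLeaf u)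
      split u with centre Fin.≟ u
      ... | yes refl rewrite centre∈ | centre-colour = refl
      ... | no z≢u with inStar u in eq
      ...   | true rewrite leaf-colour eq (z≢u ∘ sym) = refl
      ...   | false = sym (+-identityʳ _)

    -- `∏ (weight x y)` counts the maps, injective or not, that send the colour of the centre into a
    -- set of `x` vertices and the other colour into a set of `y` vertices.
    weight : ℕ → ℕ → Fin b → ℕ
    weight x y u = if col u then x else y

    ∏-weight : ∀ x y → ∏ (weight x y) ≡ x ^ (1 + matches) * y ^ (matches + leaves)
    ∏-weight x y = begin-equality
      ∏ (weight x y)                                                ≡⟨ ∏-cong split ⟩
      ∏ (λ u → x ^ 𝟙 (col u) * y ^ 𝟙 (not (col u)))                 ≡⟨ ∏-distrib-* (λ u → x ^ 𝟙 (col u)) (λ u → y ^ 𝟙 (not (col u))) ⟩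
      ∏ (λ u → x ^ 𝟙 (col u)) * ∏ (λ u → y ^ 𝟙 (not (col u)))       ≡⟨ cong₂ _*_ (∏-^ x (𝟙 ∘ col)) (∏-^ y (𝟙 ∘ not ∘ col)) ⟩
      x ^ ∑ (𝟙 ∘ col) * y ^ ∑ (𝟙 ∘ not ∘ col)                       ≡⟨ cong₂ (λ i j → x ^ i * y ^ j) col-total not-col-total ⟩
      x ^ (1 + matches) * y ^ (matches + leaves)                    ∎
      where
      split : ∀ u → weight x y u ≡ x ^ 𝟙 (col u) * y ^ 𝟙 (not (col u))
      split u with col u
      ... | true = sym (trans (*-identityʳ _) (*-identityʳ x))
      ... | false = sym (trans (*-identityˡ _) (*-identityʳ y))

    module Upper {n} (G : Adj n) (simple : SimpleGraph G) (g : Fin n → Bool) (proper : Proper G g) where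

      open BipartiteGraph G simple g proper

      private
        e = edgeCount G
        d = degree G

      orientedEdges : Bool → List (Fin n × Fin n)
      orientedEdges s = filterᵇ (λ (x , y) → oriented s x y) (concatMap (λ x → map (x ,_) (allFin n)) (allFin n))

      length-orientedEdges : ∀ s → length (orientedEdges s) ≡ e
      length-orientedEdges s = begin-equality
        length (orientedEdges s)                                  ≡⟨ count-concatMap-allFin p (λ x → map (x ,_) (allFin n)) ⟩
        ∑ (λ x → count p (map (x ,_) (allFin n)))                 ≡⟨ ∑-cong (λ x → trans (count-map p (x ,_) (allFin n)) (count-allFin (oriented s x))) ⟩
        ∑ (λ x → ∑ (λ y → 𝟙 (oriented s x y)))                    ≡⟨ oriented-total s ⟩
        e                                                         ∎
        where
        p : Fin n × Fin n → Bool
        p (x , y) = oriented s x y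

      ∈-orientedEdges : ∀ {s x y} → T (adj G x y) → g x ≡ s → (x , y) ∈ orientedEdges s
      ∈-orientedEdges {s} {x} {y} a gx≡s = ∈-filterᵇ⁺ (λ (x , y) → oriented s x y)
        (∈-concatMap⁺ (λ x → map (x ,_) (allFin n)) (Any.map (λ { refl → ∈-map⁺ (x ,_) (∈-allFin y) }) (∈-allFin x)))
        (from (T-∧ {adj G x y}) (a , fromWitness {a? = g x Bool.≟ s} gx≡s))

      -- What a vertex of `B` has to store once the centre sits at `v`: a leaf stores a neighbour of
      -- `v`, a matched vertex on the centre's side stores an oriented edge for itself and its
      -- partner. The centre and the remaining matched vertices have the single entry `(v , v)` and
      -- contribute a factor 1.
      choices : Fin n → Fin b → List (Fin n × Fin n)
      choices v u =
        if inStar u then (if centre ==F u then (v , v) ∷ [] else map (v ,_) (filterᵇ (adj G v) (allFin n)))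
        else (if col u then orientedEdges (g v) else (v , v) ∷ [])

      length-choices : ∀ v u → length (choices v u) ≡ d v ^ 𝟙 (isLeaf u) * e ^ 𝟙 (matchedTrue u)
      length-choices v u with inStar u | centre ==F u | col u
      ... | true | true | _ = refl
      ... | true | false | _ = trans (List.length-map (v ,_) (filterᵇ (adj G v) (allFin n)))
        (trans (count-allFin (adj G v)) (sym (trans (*-identityʳ _) (*-identityʳ (d v)))))
      ... | false | _ | true = trans (length-orientedEdges (g v)) (sym (trans (*-identityˡ _) (*-identityʳ e)))
      ... | false | _ | false = refl

      ∏-choices : ∀ v → ∏ (λ u → length (choices v u)) ≡ d v ^ leaves * e ^ matches
      ∏-choices v = begin-equality
        ∏ (λ u → length (choices v u))                                        ≡⟨ ∏-cong (length-choices v) ⟩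
        ∏ (λ u → d v ^ 𝟙 (isLeaf u) * e ^ 𝟙 (matchedTrue u))                  ≡⟨ ∏-distrib-* (λ u → d v ^ 𝟙 (isLeaf u)) (λ u → e ^ 𝟙 (matchedTrue u)) ⟩
        ∏ (λ u → d v ^ 𝟙 (isLeaf u)) * ∏ (λ u → e ^ 𝟙 (matchedTrue u))        ≡⟨ cong₂ _*_ (∏-^ (d v) (𝟙 ∘ isLeaf)) (∏-^ e (𝟙 ∘ matchedTrue)) ⟩
        d v ^ leaves * e ^ matches                                            ∎

      -- A matched vertex of the colour opposite to the centre is read from the edge stored at its
      -- partner.
      decode : Vec (Fin n × Fin n) b → Vec (Fin n) b
      decode κ = tabulate λ u →
        if inStar u then proj₂ (lookup κ u) else (if col u then proj₁ (lookup κ u) else proj₂ (lookup κ (partner u)))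

      module _ {f : Vec (Fin n) b} (f∈ : f ∈ withPattern G g c) where

        private
          emb = proj₁ (∈-withPattern⁻ G g c f∈)
          v = lookup f centre

        code-at : Fin b → Fin n × Fin n
        code-at u = if inStar u then (v , lookup f u)
          else (if col u then (lookup f u , lookup f (partner u)) else (v , v))

        code : Vec (Fin n × Fin n) b
        code = tabulate code-at

        code-at∈ : ∀ u → code-at u ∈ choices v u
        code-at∈ u with inStar u in u∈ | centre Fin.≟ u
        ... | true | yes refl = here refl
        ... | true | no z≢u = ∈-map⁺ (v ,_) (∈-filterᵇ⁺ (adj G v) (∈-allFin (lookup f u))
          (IsEmbedding.edges emb centre u (spoke u u∈ (z≢u ∘ sym))))
        ... | false | _ with col u in eq
        ...   | false = here refl
        ...   | true = ∈-orientedEdges (IsEmbedding.edges emb u (partner u) (partner-adj u u∈))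
          (toWitness (from T-≡ (trans (sym (proj₂ (∈-withPattern⁻ G g c f∈) u)) eq)))

        decode-code : decode code ≡ f
        decode-code = vec-ext λ u → trans (Vec.lookup∘tabulate _ u) (go u)
          where
          go : ∀ u → (if inStar u then proj₂ (lookup code u)
            else (if col u then proj₁ (lookup code u) else proj₂ (lookup code (partner u)))) ≡ lookup f u
          go u rewrite Vec.lookup∘tabulate code-at u | Vec.lookup∘tabulate code-at (partner u) with inStar u in u∈
          ... | true = refl
          ... | false with col u in eq
          ...   | true = refl
          ...   | false rewrite partner∉ u u∈ | partner-colour u∈ | eq = cong (lookup f) (partner-involutive u u∈)

      -- Every such embedding is recovered by `decode` from its code, and the code is one of the
      -- choice vectors. Injectivity and the edges of `B` outside the cover are forgotten here,
      -- which only enlarges the count.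
      length-centred : ∀ v → count (λ f → ⌊ lookup f centre Fin.≟ v ⌋) (withPattern G g c) ≤ d v ^ leaves * e ^ matches
      length-centred v = begin
        count at (withPattern G g c)              ≤⟨ unique-⊆⇒length≤ (filterᵇ-unique at (withPattern-unique G g c)) sub ⟩
        length (map decode (vectors (choices v))) ≡⟨ List.length-map decode (vectors (choices v)) ⟩
        length (vectors (choices v))              ≡⟨ length-vectors (choices v) ⟩
        ∏ (λ u → length (choices v u))            ≡⟨ ∏-choices v ⟩
        d v ^ leaves * e ^ matches                ∎
        where
        at : Vec (Fin n) b → Bool
        at f = ⌊ lookup f centre Fin.≟ v ⌋
        sub : filterᵇ at (withPattern G g c) ⊆ map decode (vectors (choices v))
        sub {f} f∈′ =
          let f∈ , atv = ∈-filterᵇ⁻ at {xs = withPattern G g c} f∈′ in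
          subst (_∈ map decode (vectors (choices v))) (decode-code f∈)
            (∈-map⁺ decode (∈-vectors (choices v) (code f∈) λ u →
              subst₂ (λ κ v → κ ∈ choices v u) (sym (Vec.lookup∘tabulate (code-at f∈) u))
                (toWitness {a? = lookup f centre Fin.≟ v} atv) (code-at∈ f∈ u)))

      length-withPattern : ∀ {s t} → (∀ v → d v ≤ s) → n ≤ s + t → e ≤ t * s →
        length (withPattern G g c) ≤ ∏ (weight t s) + ∏ (weight s t)
      length-withPattern {s} {t} d≤s n≤s+t e≤ts = begin
        length W                                                          ≡⟨ length-fibres Fin._≟_ (λ f → lookup f centre) (Unique.allFin⁺ n) W (λ _ → ∈-allFin _) ⟩
        sumᴸ (map (λ v → count (λ f → ⌊ lookup f centre Fin.≟ v ⌋) W) (allFin n))  ≡⟨ sumᴸ-tabulate (λ v → count (λ f → ⌊ lookup f centre Fin.≟ v ⌋) W) Function.id ⟩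
        ∑ (λ v → count (λ f → ⌊ lookup f centre Fin.≟ v ⌋) W)             ≤⟨ ∑-mono length-centred ⟩
        ∑ (λ v → d v ^ leaves * e ^ matches)                              ≡⟨ *-distribʳ-sum (e ^ matches) (λ v → d v ^ leaves) ⟨
        ∑ (λ v → d v ^ leaves) * e ^ matches                              ≡⟨ cong (λ j → ∑ (λ v → d v ^ j) * e ^ matches) leaves≡ ⟩
        ∑ (λ v → d v ^ suc p) * e ^ matches                               ≤⟨ *-monoˡ-≤ (e ^ matches) (degree-power-sum p d≤s n≤s+t) ⟩
        e * (s ^ p + t ^ p) * e ^ matches                                 ≡⟨ eq₁ e (s ^ p + t ^ p) (e ^ matches) ⟩
        -- The factor `e` of the degree sum has joined those of the matching edges. Each factor
        -- becomes `t * s`, that is, one vertex on each side; the other `p` leaves supply `s ^ p` or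
        -- `t ^ p` according to the side that receives them.
        e ^ (1 + matches) * (s ^ p + t ^ p)                               ≤⟨ *-monoˡ-≤ (s ^ p + t ^ p) (^-monoˡ-≤ (1 + matches) e≤ts) ⟩
        (t * s) ^ (1 + matches) * (s ^ p + t ^ p)                         ≡⟨ cong (_* (s ^ p + t ^ p)) (^-distribʳ-* (1 + matches) t s) ⟩
        t ^ (1 + matches) * s ^ (1 + matches) * (s ^ p + t ^ p)           ≡⟨ eq₂ (t ^ (1 + matches)) (s ^ (1 + matches)) (s ^ p) (t ^ p) ⟩
        t ^ (1 + matches) * (s ^ (1 + matches) * s ^ p) + s ^ (1 + matches) * (t ^ (1 + matches) * t ^ p)
          ≡⟨ cong₂ (λ x y → t ^ (1 + matches) * x + s ^ (1 + matches) * y) (collect s) (collect t) ⟩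
        t ^ (1 + matches) * s ^ (matches + leaves) + s ^ (1 + matches) * t ^ (matches + leaves)
          ≡⟨ cong₂ _+_ (∏-weight t s) (∏-weight s t) ⟨
        ∏ (weight t s) + ∏ (weight s t)                                   ∎
        where
        W = withPattern G g c
        p = pred leaves
        leaves≡ : leaves ≡ suc p
        leaves≡ = sym (suc-pred leaves ⦃ >-nonZero 0<leaves ⦄)
        collect : ∀ x → x ^ (1 + matches) * x ^ p ≡ x ^ (matches + leaves)
        collect x = trans (sym (^-distribˡ-+-* x (1 + matches) p))
          (cong (x ^_) (trans (sym (+-suc matches p)) (cong (matches +_) (sym leaves≡))))
        eq₁ : ∀ a b c → a * b * c ≡ a * c * b
        eq₁ = solve-∀
        eq₂ : ∀ a b c d → a * b * (c + d) ≡ a * (b * c) + b * (a * d)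
        eq₂ = solve-∀

-- Embeddings into B^e_n

-- `P` prescribes the candidates of each coordinate and `F` is the set already used. `F` grows with
-- every coordinate, which makes the vector injective and lets it be counted greedily.
fresh : ∀ {h n} → (Fin h → Fin n → Bool) → (Fin n → Bool) → Vec (Fin n) h → Bool
fresh P F []ᵛ = true
fresh P F (x ∷ᵛ v) = (P fzero x ∧ not (F x)) ∧ fresh (P ∘ fsuc) (λ y → F y ∨ (x ==F y)) v

fresh-allowed : ∀ {h n} (P : Fin h → Fin n → Bool) F v → T (fresh P F v) → ∀ u → T (P u (lookup v u))
fresh-allowed P F (x ∷ᵛ v) t fzero = proj₁ (to (T-∧ {P fzero x}) (proj₁ (to (T-∧ {P fzero x ∧ not (F x)}) t)))
fresh-allowed P F (x ∷ᵛ v) t (fsuc u) =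
  fresh-allowed (P ∘ fsuc) _ v (proj₂ (to (T-∧ {P fzero x ∧ not (F x)}) t)) u

fresh-avoids : ∀ {h n} (P : Fin h → Fin n → Bool) F v → T (fresh P F v) → ∀ u → T (F (lookup v u)) → ⊥
fresh-avoids P F (x ∷ᵛ v) t fzero with F x | proj₂ (to (T-∧ {P fzero x}) (proj₁ (to (T-∧ {P fzero x ∧ not (F x)}) t)))
... | false | _ = λ ()
fresh-avoids P F (x ∷ᵛ v) t (fsuc u) Fy =
  fresh-avoids (P ∘ fsuc) _ v (proj₂ (to (T-∧ {P fzero x ∧ not (F x)}) t)) u (from T-∨ (inj₁ Fy))

fresh-injective : ∀ {h n} (P : Fin h → Fin n → Bool) F v → T (fresh P F v) →
  ∀ u w → lookup v u ≡ lookup v w → u ≡ w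
fresh-injective P F (x ∷ᵛ v) t fzero fzero _ = refl
fresh-injective P F (x ∷ᵛ v) t fzero (fsuc w) eq = ⊥-elim
  (fresh-avoids (P ∘ fsuc) _ v (proj₂ (to (T-∧ {P fzero x ∧ not (F x)}) t)) w
    (from (T-∨ {F (lookup v w)}) (inj₂ (fromWitness {a? = x Fin.≟ lookup v w} eq))))
fresh-injective P F (x ∷ᵛ v) t (fsuc u) fzero eq = ⊥-elim
  (fresh-avoids (P ∘ fsuc) _ v (proj₂ (to (T-∧ {P fzero x ∧ not (F x)}) t)) u
    (from (T-∨ {F (lookup v u)}) (inj₂ (fromWitness {a? = x Fin.≟ lookup v u} (sym eq)))))
fresh-injective P F (x ∷ᵛ v) t (fsuc u) (fsuc w) eq = cong fsuc
  (fresh-injective (P ∘ fsuc) _ v (proj₂ (to (T-∧ {P fzero x ∧ not (F x)}) t)) u w eq)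

-- Greedy choice: at every coordinate fewer than `s + h` candidates have been lost. This uniform
-- loss survives the recursion, because `s` rises by one as `h` drops by one.
∏-fresh≤count : ∀ {h n} (P : Fin h → Fin n → Bool) F (q : Fin h → ℕ) s →
  (∀ u → q u ≤ ∑ (𝟙 ∘ P u)) → ∑ (𝟙 ∘ F) ≤ s →
  ∏ (λ u → q u ∸ (s + h)) ≤ count (fresh P F) (functions n h)
∏-fresh≤count {zero} P F q s _ _ = ≤-refl
∏-fresh≤count {suc h} {n} P F q s q≤ F≤s = begin
  (q fzero ∸ (s + suc h)) * ∏ (λ u → q (fsuc u) ∸ (s + suc h))
    ≤⟨ *-mono-≤ first (≤-reflexive (∏-cong λ u → cong (q (fsuc u) ∸_) (+-suc s h))) ⟩
  ∑ (𝟙 ∘ a) * R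
    ≡⟨ *-distribʳ-sum R (𝟙 ∘ a) ⟩
  ∑ (λ x → 𝟙 (a x) * R)
    ≤⟨ ∑-mono (λ x → *-monoʳ-≤ (𝟙 (a x)) (rest x)) ⟩
  ∑ (λ x → 𝟙 (a x) * count (r x) (functions n h))
    ≡⟨ ∑-cong (λ x → trans (count-map (fresh P F) (x ∷ᵛ_) (functions n h)) (count-∧ (a x) (r x) (functions n h))) ⟨
  ∑ (λ x → count (fresh P F) (map (x ∷ᵛ_) (functions n h)))
    ≡⟨ count-concatMap-allFin (fresh P F) (λ x → map (x ∷ᵛ_) (functions n h)) ⟨
  count (fresh P F) (functions n (suc h)) ∎
  where
  a : Fin n → Bool
  a x = P fzero x ∧ not (F x)
  r : Fin n → Vec (Fin n) h → Bool
  r x = fresh (P ∘ fsuc) (λ y → F y ∨ (x ==F y))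
  R = ∏ (λ u → q (fsuc u) ∸ (suc s + h))
  count-∧ : ∀ {A : Set} b (p : A → Bool) xs → count (λ x → b ∧ p x) xs ≡ 𝟙 b * count p xs
  count-∧ true p xs = sym (*-identityˡ _)
  count-∧ false p [] = refl
  count-∧ false p (_ ∷ xs) = count-∧ false p xs
  split : ∀ b c → 𝟙 b ≤ 𝟙 c + 𝟙 (b ∧ not c)
  split false c = z≤n
  split true false = ≤-refl
  split true true = ≤-refl
  first : q fzero ∸ (s + suc h) ≤ ∑ (𝟙 ∘ a)
  first = m≤n+o⇒m∸n≤o _ (s + suc h) (begin
    q fzero                                      ≤⟨ q≤ fzero ⟩
    ∑ (𝟙 ∘ P fzero)                              ≤⟨ ∑-mono (λ x → split (P fzero x) (F x)) ⟩
    ∑ (λ x → 𝟙 (F x) + 𝟙 (a x))                  ≡⟨ ∑-distrib-+ (𝟙 ∘ F) (𝟙 ∘ a) ⟩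
    ∑ (𝟙 ∘ F) + ∑ (𝟙 ∘ a)                        ≤⟨ +-monoˡ-≤ _ (≤-trans F≤s (m≤m+n s (suc h))) ⟩
    s + suc h + ∑ (𝟙 ∘ a)                        ∎)
  ∨≤+ : ∀ b c → 𝟙 (b ∨ c) ≤ 𝟙 b + 𝟙 c
  ∨≤+ false c = ≤-refl
  ∨≤+ true c = s≤s z≤n
  rest : ∀ x → R ≤ count (r x) (functions n h)
  rest x = ∏-fresh≤count (P ∘ fsuc) _ (q ∘ fsuc) (suc s) (q≤ ∘ fsuc) (begin
    ∑ (λ y → 𝟙 (F y ∨ (x ==F y)))          ≤⟨ ∑-mono (λ y → ∨≤+ (F y) (x ==F y)) ⟩
    ∑ (λ y → 𝟙 (F y) + 𝟙 (x ==F y))        ≡⟨ ∑-distrib-+ (𝟙 ∘ F) (λ y → 𝟙 (x ==F y)) ⟩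
    ∑ (𝟙 ∘ F) + ∑ (λ y → 𝟙 (x ==F y))      ≤⟨ +-mono-≤ F≤s (≤-reflexive (∑-𝟙-≟ x)) ⟩
    s + 1                                  ≡⟨ +-comm s 1 ⟩
    suc s                                  ∎)

∑-below : ∀ n {t} → t ≤ n → ∑ {n} (λ i → 𝟙 (toℕ i <ᵇ t)) ≡ t
∑-below zero z≤n = refl
∑-below (suc n) {zero} _ = trans (∑-const n 0) (*-zeroʳ n)
∑-below (suc n) {suc t} (s≤s t≤n) = cong suc (∑-below n t≤n)

∑-notBelow : ∀ n {t} → t ≤ n → ∑ {n} (λ i → 𝟙 (not (toℕ i <ᵇ t))) ≡ n ∸ t
∑-notBelow zero z≤n = refl
∑-notBelow (suc n) {zero} _ = cong suc (trans (∑-const n 1) (*-identityʳ n))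
∑-notBelow (suc n) {suc t} (s≤s t≤n) = ∑-notBelow n t≤n

∑-belowPositive : ∀ n {t} → t ≤ n → ∑ {n} (λ i → 𝟙 ((toℕ i <ᵇ t) ∧ not (toℕ i ≡ᵇ 0))) ≡ t ∸ 1
∑-belowPositive zero z≤n = refl
∑-belowPositive (suc n) {zero} _ = trans (∑-const n 0) (*-zeroʳ n)
∑-belowPositive (suc n) {suc t} (s≤s t≤n) =
  trans (∑-cong {n} λ i → cong 𝟙 (∧-identityʳ (toℕ i <ᵇ t))) (∑-below n t≤n)

∑-between : ∀ n {t d} → t + d ≤ n → ∑ {n} (λ i → 𝟙 (not (toℕ i <ᵇ t) ∧ (toℕ i <ᵇ t + d))) ≡ d
∑-between n {zero} d≤n = ∑-below n d≤n
∑-between (suc n) {suc t} (s≤s le) = ∑-between n {t} le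

firstOr-applyUpTo : ∀ d p (f : ℕ → ℕ) n k → k < n → T (p (f k)) → ∃ λ j →
  j ≤ k × firstOr d p (applyUpTo f n) ≡ f j × T (p (f j)) × (∀ i → i < j → T (p (f i)) → ⊥)
firstOr-applyUpTo d p f (suc n) k k<n pk with p (f 0) in eq
... | true = 0 , z≤n , refl , from T-≡ eq , λ _ ()
firstOr-applyUpTo d p f (suc n) zero k<n pk | false = ⊥-elim (subst T eq pk)
firstOr-applyUpTo d p f (suc n) (suc k) (s≤s k<n) pk | false =
  let j , j≤k , val , pj , first = firstOr-applyUpTo d p (f ∘ suc) n k k<n pk in
  suc j , s≤s j≤k , val , pj , λ { zero _ t → subst T eq t ; (suc i) (s≤s i<j) t → first i i<j t }

halving : ∀ n → ∃ λ h → n ≡ h + h ⊎ n ≡ h + suc h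
halving zero = 0 , inj₁ refl
halving (suc n) with halving n
... | h , inj₁ eq = h , inj₂ (trans (cong suc eq) (sym (+-suc h h)))
... | h , inj₂ eq = suc h , inj₁ (cong suc eq)

record Threshold (n e t : ℕ) : Set where
  field
    0<t : 0 < t
    2t≤n : t + t ≤ n
    e≤t*[n∸t] : e ≤ t * (n ∸ t)
    minimal : ∀ i → i < t → i * (n ∸ i) < e

-- With `h` the integer part of `n/2`, the product `h * (n ∸ h)` is the integer part of `n²/4` and
-- hence at least `e`. The search therefore stops no later than `h`, which gives `t + t ≤ n`.
tParam-threshold : ∀ {n e} → 2 ≤ n → 0 < e → 4 * e ≤ n * n → Threshold n e (tParam n e)
tParam-threshold {n} {e} 2≤n 0<e 4e≤n² with halving n
... | h , parity = record
  { 0<t = subst (0 <_) (sym t≡) (s≤s z≤n)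
  ; 2t≤n = subst (λ t → t + t ≤ n) (sym t≡) (≤-trans (+-mono-≤ suc-j≤h suc-j≤h) (2h≤n parity))
  ; e≤t*[n∸t] = subst (λ t → e ≤ t * (n ∸ t)) (sym t≡) (≤ᵇ⇒≤ _ _ (proj₁ (proj₂ (proj₂ (proj₂ found)))))
  -- The search starts at 1, so the index 0 is settled by `0 < e`.
  ; minimal = λ { zero _ → 0<e
                ; (suc i) i<t → ≰⇒> λ le → proj₂ (proj₂ (proj₂ (proj₂ found))) i
                    (≤-pred (subst (suc i <_) t≡ i<t)) (≤⇒≤ᵇ le) } }
  where
  p : ℕ → Bool
  p i = e ≤ᵇ i * (n ∸ i)
  -- The summand 1 is the remainder of `n²` modulo 4 for odd `n`.
  4*-cancel : ∀ m → 4 * e ≤ 4 * m + 1 → e ≤ m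
  4*-cancel m le = ≤-pred (*-cancelˡ-< 4 e (suc m) (begin-strict
    4 * e        ≤⟨ le ⟩
    4 * m + 1    <⟨ +-monoʳ-< (4 * m) (s≤s (s≤s z≤n)) ⟩
    4 * m + 4    ≡⟨ trans (+-comm (4 * m) 4) (sym (*-suc 4 m)) ⟩
    4 * suc m    ∎))
  2h≤n : n ≡ h + h ⊎ n ≡ h + suc h → h + h ≤ n
  2h≤n (inj₁ refl) = ≤-refl
  2h≤n (inj₂ refl) = +-monoʳ-≤ h (n≤1+n h)
  e≤h*[n∸h] : n ≡ h + h ⊎ n ≡ h + suc h → e ≤ h * (n ∸ h)
  e≤h*[n∸h] (inj₁ refl) rewrite m+n∸m≡n h h = 4*-cancel (h * h)
    (≤-trans 4e≤n² (≤-trans (≤-reflexive (square h)) (m≤m+n _ 1)))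
    where
    square : ∀ h → (h + h) * (h + h) ≡ 4 * (h * h)
    square = solve-∀
  e≤h*[n∸h] (inj₂ refl) rewrite m+n∸m≡n h (suc h) = 4*-cancel (h * suc h)
    (≤-trans 4e≤n² (≤-reflexive (square h)))
    where
    square : ∀ h → (h + suc h) * (h + suc h) ≡ 4 * (h * suc h) + 1
    square = solve-∀
  positive : ∀ {n} h → 2 ≤ n → n ≡ h + h ⊎ n ≡ h + suc h → 0 < h
  positive (suc _) _ _ = s≤s z≤n
  positive zero () (inj₁ refl)
  positive zero (s≤s ()) (inj₂ refl)
  h≡ : suc (pred h) ≡ h
  h≡ = suc-pred h ⦃ >-nonZero (positive h 2≤n parity) ⦄
  -- The list searched is 1, ..., n, so the value `h` stands at position `pred h`.
  found = firstOr-applyUpTo n p suc n (pred h)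
    (≤-trans (≤-reflexive h≡) (≤-trans (m≤m+n h h) (2h≤n parity)))
    (≤⇒≤ᵇ (subst (λ h → e ≤ h * (n ∸ h)) (sym h≡) (e≤h*[n∸h] parity)))
  j = proj₁ found
  suc-j≤h : suc j ≤ h
  suc-j≤h = ≤-trans (s≤s (proj₁ (proj₂ found))) (≤-reflexive h≡)
  t≡ : tParam n e ≡ suc j
  t≡ = trans (cong (firstOr n p) (List.map-upTo suc n)) (proj₁ (proj₂ (proj₂ found)))

T≡true : ∀ {a} → T a → a ≡ true
T≡true = to T-≡

module BenGraph {n e} (threshold : Threshold n e (tParam n e)) where

  open Threshold threshold

  t d : ℕ
  t = tParam n e
  d = t * (n ∸ t) ∸ e

  t≤n : t ≤ n
  t≤n = ≤-trans (m≤m+n t t) 2t≤n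

  inA : Fin n → Bool
  inA i = toℕ i <ᵇ t

  deleted half : Fin n → Fin n → Bool
  deleted i j = (toℕ i ≡ᵇ 0) ∧ (toℕ j <ᵇ t + d)
  half i j = inA i ∧ not (inA j) ∧ not (deleted i j)

  adj-Ben : ∀ i j → adj (Ben n e) i j ≡ half i j ∨ half j i
  adj-Ben = adj-tabulate (λ i j → half i j ∨ half j i)

  half⇒ : ∀ {i j} → T (half i j) → inA i ≡ true × inA j ≡ false
  half⇒ {i} {j} h with inA i | inA j
  ... | true | false = refl , refl

  simple : SimpleGraph (Ben n e)
  simple = (λ i j → trans (adj-Ben i j) (trans (∨-comm (half i j) (half j i)) (sym (adj-Ben j i)))) , irr
    where
    irr : ∀ i → adj (Ben n e) i i ≡ false
    irr i rewrite adj-Ben i i with inA i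
    ... | false = refl
    ... | true = refl

  proper : Proper (Ben n e) inA
  proper i j a eq with to (T-∨ {half i j}) (subst T (adj-Ben i j) a)
  ... | inj₁ h = contradiction (trans (sym (proj₁ (half⇒ h))) (trans eq (proj₂ (half⇒ h)))) λ ()
  ... | inj₂ h = contradiction (trans (sym (proj₁ (half⇒ h))) (trans (sym eq) (proj₂ (half⇒ h)))) λ ()

  -- By minimality `t - 1` is too small, that is `(t - 1)(n - t + 1) < e`; so `t(n - t)` exceeds `e`
  -- by at most `n - t`, and vertex 0 has enough edges to lose.
  d≤n∸t : d ≤ n ∸ t
  d≤n∸t = m≤n+o⇒m∸n≤o _ e (begin
    t * (n ∸ t)                               ≡⟨ cong (_* (n ∸ t)) t≡ ⟩
    n ∸ t + pred t * (n ∸ t)                  ≤⟨ +-monoʳ-≤ (n ∸ t) (*-monoʳ-≤ (pred t) (∸-monoʳ-≤ n (pred[n]≤n {t}))) ⟩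
    n ∸ t + pred t * (n ∸ pred t)             ≤⟨ +-monoʳ-≤ (n ∸ t) (<⇒≤ (minimal (pred t) (≤-reflexive (sym t≡)))) ⟩
    n ∸ t + e                                 ≡⟨ +-comm (n ∸ t) e ⟩
    e + (n ∸ t)                               ∎)
    where
    t≡ : t ≡ suc (pred t)
    t≡ = sym (suc-pred t ⦃ >-nonZero 0<t ⦄)

  edgeCount-Ben : edgeCount (Ben n e) ≡ e
  edgeCount-Ben = begin-equality
    edgeCount (Ben n e)                                   ≡⟨ edgeCount≡∑∑ (Ben n e) ⟩
    ∑ (λ i → ∑ (λ j → 𝟙 (toℕ i <ᵇ toℕ j) * 𝟙 (adj (Ben n e) i j)))  ≡⟨ ∑∑-cong upper ⟩
    X                                                     ≡⟨ m+n∸n≡m X d ⟨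
    X + d ∸ d                                             ≡⟨ cong (_∸ d) total ⟩
    t * (n ∸ t) ∸ d                                       ≡⟨ m∸[m∸n]≡n e≤t*[n∸t] ⟩
    e                                                     ∎
    where
    X = ∑ (λ i → ∑ (λ j → 𝟙 (half i j)))
    -- The `t`-side carries the smaller labels, so the condition `i < j` selects precisely the
    -- orientation that starts there.
    upper : ∀ i j → 𝟙 (toℕ i <ᵇ toℕ j) * 𝟙 (adj (Ben n e) i j) ≡ 𝟙 (half i j)
    upper i j rewrite adj-Ben i j with half i j in h | half j i in h′
    ... | true | _ rewrite <ᵇ-true (<-≤-trans (<ᵇ⇒< (toℕ i) t (from T-≡ (proj₁ (half⇒ {i} {j} (from T-≡ h)))))
                                      (≮⇒≥ λ j<t → subst T (proj₂ (half⇒ {i} {j} (from T-≡ h))) (<⇒<ᵇ j<t))) = refl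
    ... | false | false = *-zeroʳ (𝟙 (toℕ i <ᵇ toℕ j))
    ... | false | true rewrite <ᵇ-false (<⇒≤ (<-≤-trans (<ᵇ⇒< (toℕ j) t (from T-≡ (proj₁ (half⇒ {j} {i} (from T-≡ h′)))))
                                      (≮⇒≥ λ i<t → subst T (proj₂ (half⇒ {j} {i} (from T-≡ h′))) (<⇒<ᵇ i<t)))) = refl
    -- The deleted pairs. With those of `half` they make up all of `K_{t,n-t}`, which yields the
    -- edge count by subtraction.
    below : Fin n → Fin n → Bool
    below i j = inA i ∧ not (inA j) ∧ deleted i j
    Y = λ j → 𝟙 (not (inA j) ∧ (toℕ j <ᵇ t + d))
    below≡ : ∀ i j → 𝟙 (below i j) ≡ 𝟙 (toℕ i ≡ᵇ 0) * Y j
    below≡ i j with toℕ i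
    ... | zero rewrite <ᵇ-true 0<t = sym (*-identityˡ _)
    ... | suc k rewrite ∧-zeroʳ (not (inA j)) | ∧-zeroʳ (suc k <ᵇ t) = refl
    one : ∀ n → 0 < n → ∑ {n} (λ i → 𝟙 (toℕ i ≡ᵇ 0)) ≡ 1
    one (suc n) _ = cong suc (trans (∑-const n 0) (*-zeroʳ n))
    below-total : ∑ (λ i → ∑ (λ j → 𝟙 (below i j))) ≡ d
    below-total = begin-equality
      ∑ (λ i → ∑ (λ j → 𝟙 (below i j)))                   ≡⟨ ∑∑-cong below≡ ⟩
      ∑ {n} (λ i → ∑ (λ j → 𝟙 (toℕ i ≡ᵇ 0) * Y j))            ≡⟨ ∑∑-* {n} (λ i → 𝟙 (toℕ i ≡ᵇ 0)) Y ⟨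
      ∑ {n} (λ i → 𝟙 (toℕ i ≡ᵇ 0)) * ∑ Y                  ≡⟨ cong₂ _*_ (one n (<-≤-trans 0<t t≤n))
                                                               (∑-between n {t} (≤-trans (+-monoʳ-≤ t d≤n∸t) (≤-reflexive (m+[n∸m]≡n t≤n)))) ⟩
      1 * d                                               ≡⟨ *-identityˡ d ⟩
      d                                                   ∎
    split : ∀ a b c → 𝟙 (a ∧ b ∧ not c) + 𝟙 (a ∧ b ∧ c) ≡ 𝟙 a * 𝟙 b
    split false b c = refl
    split true false c = refl
    split true true false = refl
    split true true true = refl
    total : X + d ≡ t * (n ∸ t)
    total = begin-equality
      X + d                                               ≡⟨ cong (X +_) below-total ⟨
      X + ∑ (λ i → ∑ (λ j → 𝟙 (below i j)))               ≡⟨ ∑∑-distrib-+ (λ i j → 𝟙 (half i j)) (λ i j → 𝟙 (below i j)) ⟩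
      ∑ (λ i → ∑ (λ j → 𝟙 (half i j) + 𝟙 (below i j)))    ≡⟨ ∑∑-cong (λ i j → split (inA i) (not (inA j)) (deleted i j)) ⟩
      ∑ (λ i → ∑ (λ j → 𝟙 (inA i) * 𝟙 (not (inA j))))     ≡⟨ ∑∑-* (𝟙 ∘ inA) (𝟙 ∘ not ∘ inA) ⟨
      ∑ (𝟙 ∘ inA) * ∑ (𝟙 ∘ not ∘ inA)                     ≡⟨ cong₂ _*_ (∑-below n t≤n) (∑-notBelow n t≤n) ⟩
      t * (n ∸ t)                                         ∎

  -- Vertex 0 is the only vertex of the `t`-side that may have lost edges; the others are joined to
  -- the whole opposite side.
  inA′ : Fin n → Bool
  inA′ i = inA i ∧ not (toℕ i ≡ᵇ 0)

  adj-Ben⁺ : ∀ {i j} → T (inA′ i) → inA j ≡ false → T (adj (Ben n e) i j) × T (adj (Ben n e) j i)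
  adj-Ben⁺ {i} {j} ti fj =
    subst T (sym (adj-Ben i j)) (from (T-∨ {half i j}) (inj₁ h)) ,
    subst T (sym (adj-Ben j i)) (from (T-∨ {half j i}) (inj₂ h))
    where
    h : T (half i j)
    h with inA i | toℕ i ≡ᵇ 0
    ... | true | false rewrite fj = _

  module _ {b} (B : Adj b) (cover : StarCover B) where

    open Pattern B cover
    open StarCover cover using (centre)

    module _ {c : Vec Bool b} (isPat : IsPattern c) where

      open IsPattern isPat

      -- Admissible images when the vertices of colour s go to the t-side.
      allowed : Bool → Fin b → Fin n → Bool
      allowed s u x = if (lookup c u ==B s) then inA′ x else not (inA x)

      allowed⇒inA : ∀ s u x → T (allowed s u x) → inA x ≡ (lookup c u ==B s)
      allowed⇒inA s u x a with lookup c u ==B s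
      ... | true = T≡true (proj₁ (to (T-∧ {inA x}) a))
      ... | false = to T-not-≡ a

      allowed⇒adj : ∀ s u w x y → lookup c u ≢ lookup c w → T (allowed s u x) → T (allowed s w y) →
        T (adj (Ben n e) x y)
      allowed⇒adj s u w x y cu≢cw ax ay with lookup c u Bool.≟ s | lookup c w Bool.≟ s
      ... | yes cu≡s | yes cw≡s = contradiction (trans cu≡s (sym cw≡s)) cu≢cw
      ... | yes _ | no _ = proj₁ (adj-Ben⁺ ax (to T-not-≡ ay))
      ... | no _ | yes _ = proj₂ (adj-Ben⁺ ay (to T-not-≡ ax))
      ... | no cu≢s | no cw≢s = contradiction (two-colours cu≢s (cw≢s ∘ sym)) cu≢cw

      placements : Bool → List (Vec (Fin n) b)
      placements s = filterᵇ (fresh (allowed s) (λ _ → false)) (functions n b)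

      ∈-placements⁻ : ∀ s {f} → f ∈ placements s → T (fresh (allowed s) (λ _ → false) f)
      ∈-placements⁻ s f∈ = proj₂ (∈-filterᵇ⁻ (fresh (allowed s) (λ _ → false)) {xs = functions n b} f∈)

      placement-colour : ∀ s {f} → f ∈ placements s → ∀ u → inA (lookup f u) ≡ (lookup c u ==B s)
      placement-colour s {f} f∈ u =
        allowed⇒inA s u (lookup f u) (fresh-allowed (allowed s) _ f (∈-placements⁻ s f∈) u)

      -- Comparing each vertex with the centre cancels the choice of `s`, so both placements fall
      -- into the same class.
      placement-pattern : ∀ s {f} → f ∈ placements s → f ∈ withPattern (Ben n e) inA c
      placement-pattern s {f} f∈ = ∈-withPattern⁺ (Ben n e) inA c
        (record { injective = fresh-injective (allowed s) _ f fr
                ; edges = λ u w a → allowed⇒adj s u w (lookup f u) (lookup f w) (bichromatic u w a)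
                    (fresh-allowed (allowed s) _ f fr u) (fresh-allowed (allowed s) _ f fr w) })
        λ u → trans (lem (lookup c u) s) (sym (cong₂ _==B_ (placement-colour s f∈ u)
          (trans (placement-colour s f∈ centre) (cong (_==B s) centre-colour))))
        where
        fr = ∈-placements⁻ s f∈
        lem : ∀ a s → a ≡ ((a ==B s) ==B (true ==B s))
        lem false false = refl
        lem false true = refl
        lem true false = refl
        lem true true = refl

      -- The loss `suc b` consists of `b` for the vertices already used and 1 for vertex 0. It is
      -- charged on both sides so that every factor has the same form.
      ∏-weight≤placements : ∀ s → ∏ (λ u → (if (lookup c u ==B s) then t else n ∸ t) ∸ suc b) ≤ length (placements s)
      ∏-weight≤placements s = ≤-trans (∏-mono shift)
        (∏-fresh≤count (allowed s) (λ _ → false) q 0 q≤ (≤-reflexive (trans (∑-const n 0) (*-zeroʳ n))))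
        where
        q : Fin b → ℕ
        q u = if (lookup c u ==B s) then t ∸ 1 else n ∸ t
        q≤ : ∀ u → q u ≤ ∑ (𝟙 ∘ allowed s u)
        q≤ u with lookup c u ==B s
        ... | true = ≤-reflexive (sym (∑-belowPositive n t≤n))
        ... | false = ≤-reflexive (sym (∑-notBelow n t≤n))
        shift : ∀ u → (if (lookup c u ==B s) then t else n ∸ t) ∸ suc b ≤ q u ∸ b
        shift u with lookup c u ==B s
        ... | true = ≤-reflexive (sym (∸-+-assoc t 1 b))
        ... | false = ∸-monoʳ-≤ (n ∸ t) (n≤1+n b)

      -- The two placements put the centre on different sides, hence are disjoint, and their counts
      -- add up. The summands mirror those of the upper bound.
      length-withPattern≥ : ∏ (λ u → weight isPat t (n ∸ t) u ∸ suc b) + ∏ (λ u → weight isPat (n ∸ t) t u ∸ suc b)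
        ≤ length (withPattern (Ben n e) inA c)
      length-withPattern≥ = begin
        ∏ (λ u → weight isPat t (n ∸ t) u ∸ suc b) + ∏ (λ u → weight isPat (n ∸ t) t u ∸ suc b)
          ≡⟨ cong₂ _+_ (∏-cong λ u → cong (_∸ suc b) (eqᵗ (lookup c u))) (∏-cong λ u → cong (_∸ suc b) (eqᶠ (lookup c u))) ⟩
        ∏ (λ u → (if (lookup c u ==B true) then t else n ∸ t) ∸ suc b) +
          ∏ (λ u → (if (lookup c u ==B false) then t else n ∸ t) ∸ suc b)
          ≤⟨ +-mono-≤ (∏-weight≤placements true) (∏-weight≤placements false) ⟩
        length (placements true) + length (placements false)
          ≡⟨ List.length-++ (placements true) ⟨
        length (placements true ++ placements false)
          ≤⟨ unique-⊆⇒length≤ (Unique.++⁺ (unique true) (unique false) disjoint) sub ⟩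
        length (withPattern (Ben n e) inA c) ∎
        where
        eqᵗ : ∀ a → (if a then t else n ∸ t) ≡ (if (a ==B true) then t else n ∸ t)
        eqᵗ false = refl
        eqᵗ true = refl
        eqᶠ : ∀ a → (if a then n ∸ t else t) ≡ (if (a ==B false) then t else n ∸ t)
        eqᶠ false = refl
        eqᶠ true = refl
        unique : ∀ s → Unique (placements s)
        unique s = filterᵇ-unique (fresh (allowed s) (λ _ → false)) (vecs-unique (Unique.allFin⁺ n) b)
        disjoint : ∀ {f} → f ∈ placements true × f ∈ placements false → ⊥
        disjoint (f∈₁ , f∈₂) with trans (sym (placement-colour true f∈₁ centre)) (placement-colour false f∈₂ centre)
        ... | eq rewrite centre-colour with () ← eq
        sub : placements true ++ placements false ⊆ withPattern (Ben n e) inA c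
        sub f∈ with ∈-++⁻ (placements true) f∈
        ... | inj₁ f∈₁ = placement-pattern true f∈₁
        ... | inj₂ f∈₂ = placement-pattern false f∈₂

-- Comparison of the two bounds

-- Bernoulli's inequality `(1 - 1/Q)^b ≥ 1 - b/Q` without division: replacing one factor of `x` by
-- that of `y` costs at most one further `∏ x`.
∏-perturb : ∀ Q {b} (x y : Vector ℕ b) → (∀ u → y u ≤ x u) → (∀ u → Q * x u ≤ Q * y u + x u) →
  Q * ∏ x ≤ Q * ∏ y + b * ∏ x
∏-perturb Q {zero} x y _ _ = m≤m+n _ 0
∏-perturb Q {suc b} x y y≤x near = begin
  Q * (x₀ * X)                          ≡⟨ *-assoc Q x₀ X ⟨
  Q * x₀ * X                            ≤⟨ *-monoˡ-≤ X (near fzero) ⟩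
  (Q * y₀ + x₀) * X                     ≡⟨ eq₁ Q y₀ x₀ X ⟩
  y₀ * (Q * X) + x₀ * X                 ≤⟨ +-monoˡ-≤ (x₀ * X) (*-monoʳ-≤ y₀ (∏-perturb Q (x ∘ fsuc) (y ∘ fsuc) (y≤x ∘ fsuc) (near ∘ fsuc))) ⟩
  y₀ * (Q * Y + b * X) + x₀ * X         ≡⟨ eq₂ Q y₀ Y b X x₀ ⟩
  Q * (y₀ * Y) + (x₀ * X + y₀ * (b * X)) ≤⟨ +-monoʳ-≤ (Q * (y₀ * Y)) (+-monoʳ-≤ (x₀ * X) (*-monoˡ-≤ (b * X) (y≤x fzero))) ⟩
  Q * (y₀ * Y) + (x₀ * X + x₀ * (b * X)) ≡⟨ eq₃ (Q * (y₀ * Y)) x₀ X b ⟩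
  Q * (y₀ * Y) + suc b * (x₀ * X)       ∎
  where
  x₀ = x fzero
  y₀ = y fzero
  X = ∏ (x ∘ fsuc)
  Y = ∏ (y ∘ fsuc)
  eq₁ : ∀ Q y x X → (Q * y + x) * X ≡ y * (Q * X) + x * X
  eq₁ = solve-∀
  eq₂ : ∀ Q y Y b X x → y * (Q * Y + b * X) + x * X ≡ Q * (y * Y) + (x * X + y * (b * X))
  eq₂ = solve-∀
  eq₃ : ∀ A x X b → A + (x * X + x * (b * X)) ≡ A + suc b * (x * X)
  eq₃ = solve-∀

∏-∸-large : ∀ k {b} r (x : Vector ℕ b) → 0 < b → (∀ u → suc k * b * r ≤ x u) →
  k * ∏ x ≤ suc k * ∏ (λ u → x u ∸ r)
∏-∸-large k {b} r x 0<b large = *-cancelˡ-≤ b ⦃ >-nonZero 0<b ⦄ (+-cancelˡ-≤ (b * X) _ _ (begin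
  b * X + b * (k * X)           ≡⟨ eq₁ b X k ⟩
  suc k * b * X                 ≤⟨ ∏-perturb (suc k * b) x (λ u → x u ∸ r) (λ u → m∸n≤m (x u) r) near ⟩
  suc k * b * Y + b * X         ≡⟨ eq₂ b Y k (b * X) ⟩
  b * X + b * (suc k * Y)       ∎))
  where
  X = ∏ x
  Y = ∏ (λ u → x u ∸ r)
  -- The total relative loss `b/Q` is then `1/(k+1)`. A single factor loses at most the fraction
  -- `1/Q` as soon as `Q * r ≤ x u`.
  Q = suc k * b
  near : ∀ u → Q * x u ≤ Q * (x u ∸ r) + x u
  near u = begin
    Q * x u                         ≤⟨ *-monoʳ-≤ Q (m≤n+m∸n (x u) r) ⟩
    Q * (r + (x u ∸ r))             ≡⟨ *-distribˡ-+ Q r (x u ∸ r) ⟩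
    Q * r + Q * (x u ∸ r)           ≤⟨ +-monoˡ-≤ _ (large u) ⟩
    x u + Q * (x u ∸ r)             ≡⟨ +-comm (x u) _ ⟩
    Q * (x u ∸ r) + x u             ∎
  eq₁ : ∀ b X k → b * X + b * (k * X) ≡ suc k * b * X
  eq₁ = solve-∀
  eq₂ : ∀ b Y k Z → suc k * b * Y + Z ≡ Z + b * (suc k * Y)
  eq₂ = solve-∀

-- Admissible graphs and the maximum `exBip`

isSimpleᵇ⁻ : (G : Adj n) → T (isSimpleᵇ G) → SimpleGraph G
isSimpleᵇ⁻ {n} G t =
  (λ i j → toWitness {a? = adj G i j Bool.≟ adj G j i}
    (all-allFin⁻ (λ j → adj G i j ==B adj G j i) (all-allFin⁻ (λ i → all (λ j → adj G i j ==B adj G j i) (allFin n)) (proj₁ both) i) j)) ,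
  (λ i → to T-not-≡ (all-allFin⁻ (λ i → not (adj G i i)) (proj₂ both) i))
  where
  both = to (T-∧ {all (λ i → all (λ j → adj G i j ==B adj G j i) (allFin n)) (allFin n)}) t

isSimpleᵇ⁺ : (G : Adj n) → SimpleGraph G → T (isSimpleᵇ G)
isSimpleᵇ⁺ {n} G (symm , irr) = from (T-∧ {all (λ i → all (λ j → adj G i j ==B adj G j i) (allFin n)) (allFin n)})
  ( all-allFin⁺ (λ i → all (λ j → adj G i j ==B adj G j i) (allFin n))
      (λ i → all-allFin⁺ (λ j → adj G i j ==B adj G j i) (λ j → fromWitness {a? = adj G i j Bool.≟ adj G j i} (symm i j)))
  , all-allFin⁺ (λ i → not (adj G i i)) (λ i → from T-not-≡ (irr i)) )

module _ {n} (G : Adj n) where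

  private
    differ : Vec Bool n → Fin n → Fin n → Bool
    differ c i j = not (adj G i j) ∨ not (lookup c i ==B lookup c j)

    isColouring : Vec Bool n → Bool
    isColouring c = all (λ i → all (differ c i) (allFin n)) (allFin n)

  isBipartiteᵇ⁻ : T (isBipartiteᵇ G) → ∃ (Proper G)
  isBipartiteᵇ⁻ t = lookup c , λ i j a eq → ne (adj G i j) (lookup c i) (lookup c j) a eq
    (all-allFin⁻ (differ c i) (all-allFin⁻ (λ i → all (differ c i) (allFin n)) ok i) j)
    where
    found = find (Any.any⁻ isColouring (vecs bools n) t)
    c = proj₁ found
    ok = proj₂ (proj₂ found)
    ne : ∀ a x y → T a → x ≡ y → T (not a ∨ not (x ==B y)) → ⊥
    ne true false false _ _ ()
    ne true true true _ _ ()
    ne true true false _ ()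
    ne true false true _ ()

  isBipartiteᵇ⁺ : (g : Fin n → Bool) → Proper G g → T (isBipartiteᵇ G)
  isBipartiteᵇ⁺ g proper = Any.any⁺ isColouring (lose (∈-vecs ∈-bools c)
    (all-allFin⁺ (λ i → all (differ c i) (allFin n)) (λ i → all-allFin⁺ (differ c i) (λ j → ok i j))))
    where
    c = tabulate g
    ne : ∀ a x y → (T a → x ≢ y) → T (not a ∨ not (x ==B y))
    ne false x y _ = _
    ne true false false h = h _ refl
    ne true true true h = h _ refl
    ne true true false h = _
    ne true false true h = _
    ok : ∀ i j → T (differ c i j)
    ok i j rewrite Vec.lookup∘tabulate g i | Vec.lookup∘tabulate g j = ne (adj G i j) (g i) (g j) (proper i j)

admissible : ∀ {n} → ℕ → Adj n → Bool
admissible e G = isSimpleᵇ G ∧ isBipartiteᵇ G ∧ (edgeCount G ≡ᵇ e)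

admissible⁻ : ∀ {n e} (G : Adj n) → T (admissible e G) → SimpleGraph G × ∃ (Proper G) × edgeCount G ≡ e
admissible⁻ {e = e} G t =
  let s , t′ = to (T-∧ {isSimpleᵇ G}) t ; b , c = to (T-∧ {isBipartiteᵇ G}) t′ in
  isSimpleᵇ⁻ G s , isBipartiteᵇ⁻ G b , ≡ᵇ⇒≡ (edgeCount G) e c

admissible⁺ : ∀ {n e} (G : Adj n) → SimpleGraph G → ∀ g → Proper G g → edgeCount G ≡ e → T (admissible e G)
admissible⁺ {e = e} G s g proper c = from (T-∧ {isSimpleᵇ G})
  (isSimpleᵇ⁺ G s , from (T-∧ {isBipartiteᵇ G}) (isBipartiteᵇ⁺ G g proper , ≡⇒≡ᵇ (edgeCount G) e c))

module _ {A : Set} (f : A → ℕ) where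

  max : List A → ℕ
  max xs = foldr _⊔_ 0 (map f xs)

  ≤-max : ∀ {x xs} → x ∈ xs → f x ≤ max xs
  ≤-max (here refl) = m≤m⊔n _ _
  ≤-max (there x∈) = ≤-trans (≤-max x∈) (m≤n⊔m _ _)

  -- The factor `k` is carried through the maximum, so that a bound on `k * f x` need not be divided
  -- by `k`.
  *-max-lub : ∀ k {m} xs → (∀ {x} → x ∈ xs → k * f x ≤ m) → k * max xs ≤ m
  *-max-lub k [] _ = ≤-trans (≤-reflexive (*-zeroʳ k)) z≤n
  *-max-lub k (x ∷ xs) ub = ≤-trans (≤-reflexive (*-distribˡ-⊔ k (f x) (max xs)))
    (⊔-lub (ub (here refl)) (*-max-lub k xs (ub ∘ there)))

N≤exBip : ∀ {b n e} (B : Adj b) (G : Adj n) → T (admissible e G) → N B G ≤ exBip n e B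
N≤exBip {n = n} {e} B G ok = ≤-max (N B) (∈-filterᵇ⁺ (admissible e) (∈-vecs (∈-vecs ∈-bools) G) ok)

*-exBip-lub : ∀ k {b n e m} (B : Adj b) → (∀ (G : Adj n) → T (admissible e G) → k * N B G ≤ m) → k * exBip n e B ≤ m
*-exBip-lub k {n = n} {e} B ub = *-max-lub (N B) k (filterᵇ (admissible e) (allAdj n))
  λ {G} G∈ → ub G (proj₂ (∈-filterᵇ⁻ (admissible e) {xs = allAdj n} G∈))

-- The comparison for large `n` and the theorem

module _ {b} (B : Adj b) (cover : StarCover B) where

  open Pattern B cover

  N-bound : ∀ k {n e} → (suc k * b * suc b) * n ≤ e → Threshold n e (tParam n e) →
    (G : Adj n) → T (admissible e G) → k * N B G ≤ suc k * N B (Ben n e)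
  N-bound k {n} {e} large threshold G ok = *-cancelʳ-≤ _ _ a ⦃ >-nonZero 0<automorphisms ⦄ (begin
    k * N B G * a                              ≡⟨ *-assoc k (N B G) a ⟩
    k * (N B G * a)                            ≡⟨ cong (k *_) (N*automorphisms G) ⟩
    k * length (embeddings B G)                ≤⟨ embeddings-bound ⟩
    suc k * length (embeddings B (Ben n e))    ≡⟨ cong (suc k *_) (N*automorphisms (Ben n e)) ⟨
    suc k * (N B (Ben n e) * a)                ≡⟨ *-assoc (suc k) (N B (Ben n e)) a ⟨
    suc k * N B (Ben n e) * a                  ∎)
    where
    open Quotient B
    open Threshold threshold
    module Bn = BenGraph threshold
    open Bn using (t; inA)
    a = length automorphisms
    simple = proj₁ (admissible⁻ {e = e} G ok)
    g = proj₁ (proj₁ (proj₂ (admissible⁻ {e = e} G ok)))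
    proper = proj₂ (proj₁ (proj₂ (admissible⁻ {e = e} G ok)))
    edges≡ = proj₂ (proj₂ (admissible⁻ {e = e} G ok))
    0<b : 0 < b
    0<b = ≤-<-trans z≤n (Fin.toℕ<n (StarCover.centre cover))
    0<n : 0 < n
    0<n = <-≤-trans 0<t Bn.t≤n
    -- The size that `∏-∸-large` asks of every factor when the loss is `r = suc b`. Both `t` and
    -- `n ∸ t` reach it.
    M = suc k * b * suc b
    M≤t : M ≤ t
    M≤t = *-cancelʳ-≤ M t n ⦃ >-nonZero 0<n ⦄ (begin
      M * n           ≤⟨ large ⟩
      e               ≤⟨ e≤t*[n∸t] ⟩
      t * (n ∸ t)     ≤⟨ *-monoʳ-≤ t (m∸n≤m n t) ⟩
      t * n           ∎)
    t≤n∸t : t ≤ n ∸ t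
    t≤n∸t = m+n≤o⇒m≤o∸n t 2t≤n
    if-large : ∀ (c : Bool) {x y} → M ≤ x → M ≤ y → M ≤ (if c then x else y)
    if-large true p q = p
    if-large false p q = q
    pattern-bound : ∀ c → k * length (withPattern G g c) ≤ suc k * length (withPattern (Ben n e) inA c)
    pattern-bound c = go (withPattern G g c) refl
      where
      -- An empty class needs no estimate; a member of a nonempty one certifies that `c` is a proper
      -- pattern, on which both bounds depend.
      go : ∀ W → withPattern G g c ≡ W → k * length W ≤ suc k * length (withPattern (Ben n e) inA c)
      go [] _ = ≤-trans (≤-reflexive (*-zeroʳ k)) z≤n
      go (f ∷ fs) eq = begin
        k * length (f ∷ fs)                       ≡⟨ cong (λ W → k * length W) eq ⟨
        k * length (withPattern G g c)            ≤⟨ *-monoʳ-≤ k (Upper.length-withPattern isPat G simple g proper degree≤ n≤ e≤) ⟩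
        k * (∏ w₁ + ∏ w₂)                         ≡⟨ *-distribˡ-+ k (∏ w₁) (∏ w₂) ⟩
        k * ∏ w₁ + k * ∏ w₂                       ≤⟨ +-mono-≤ (∏-∸-large k (suc b) w₁ 0<b (λ u → if-large (lookup c u) M≤t M≤n∸t))
                                                              (∏-∸-large k (suc b) w₂ 0<b (λ u → if-large (lookup c u) M≤n∸t M≤t)) ⟩
        suc k * ∏ (λ u → w₁ u ∸ suc b) + suc k * ∏ (λ u → w₂ u ∸ suc b)
          ≡⟨ *-distribˡ-+ (suc k) (∏ (λ u → w₁ u ∸ suc b)) (∏ (λ u → w₂ u ∸ suc b)) ⟨
        suc k * (∏ (λ u → w₁ u ∸ suc b) + ∏ (λ u → w₂ u ∸ suc b))
          ≤⟨ *-monoʳ-≤ (suc k) (Bn.length-withPattern≥ B cover isPat) ⟩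
        suc k * length (withPattern (Ben n e) inA c) ∎
        where
        isPat : IsPattern c
        isPat = withPattern⇒IsPattern {G = G} proper {c} {f} (subst (f ∈_) (sym eq) (here refl))
        M≤n∸t = ≤-trans M≤t t≤n∸t
        w₁ = weight isPat t (n ∸ t)
        w₂ = weight isPat (n ∸ t) t
        degree≤ : ∀ v → degree G v ≤ n ∸ t
        degree≤ = BipartiteGraph.degree≤n∸t G simple g proper t
          (λ i i<t → <-≤-trans (minimal i i<t) (≤-reflexive (sym edges≡)))
        n≤ : n ≤ n ∸ t + t
        n≤ = ≤-reflexive (sym (m∸n+n≡m Bn.t≤n))
        e≤ : edgeCount G ≤ t * (n ∸ t)
        e≤ = ≤-trans (≤-reflexive edges≡) e≤t*[n∸t]
    embeddings-bound : k * length (embeddings B G) ≤ suc k * length (embeddings B (Ben n e))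
    embeddings-bound = begin
      k * length (embeddings B G)                                             ≡⟨ cong (k *_) (length-embeddings G g) ⟩
      k * sumᴸ (map (λ c → length (withPattern G g c)) (vecs bools b))        ≡⟨ sumᴸ-* k (λ c → length (withPattern G g c)) (vecs bools b) ⟩
      sumᴸ (map (λ c → k * length (withPattern G g c)) (vecs bools b))        ≤⟨ sumᴸ-mono (vecs bools b) (λ {c} _ → pattern-bound c) ⟩
      sumᴸ (map (λ c → suc k * length (withPattern (Ben n e) inA c)) (vecs bools b))  ≡⟨ sumᴸ-* (suc k) (λ c → length (withPattern (Ben n e) inA c)) (vecs bools b) ⟨
      suc k * sumᴸ (map (λ c → length (withPattern (Ben n e) inA c)) (vecs bools b))  ≡⟨ cong (suc k *_) (length-embeddings (Ben n e) inA) ⟨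
      suc k * length (embeddings B (Ben n e))                                 ∎

-- Without a star, any matching edge serves as a star with one leaf.
starCover : ∀ {b} (B : Adj (suc b)) → CoveredByEdgesAndStar B → StarCover B
starCover B (inStar , partner , matched , inj₂ (z , l , _ , z∈ , l∈ , _ , l≢z , _ , _ , spoke)) = record
  { inStar = inStar ; partner = partner ; centre = z ; leaf = l ; centre∈ = z∈ ; leaf∈ = l∈ ; leaf≢centre = l≢z
  ; spoke = λ w w∈ w≢z → from T-≡ (spoke w w∈ w≢z)
  ; partner∉ = λ v v∉ → proj₁ (proj₂ (matched v v∉))
  ; partner-involutive = λ v v∉ → proj₁ (proj₂ (proj₂ (matched v v∉)))
  ; partner-adj = λ v v∉ → from T-≡ (proj₂ (proj₂ (proj₂ (matched v v∉)))) }
starCover {b} B (inStar , partner , matched , inj₁ none) = record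
  { inStar = inEdge ; partner = partner ; centre = z ; leaf = l
  ; centre∈ = refl
  ; leaf∈ = trans (cong ((z ==F l) ∨_) (==F-true refl)) (∨-zeroʳ (z ==F l))
  ; leaf≢centre = proj₁ (matched z (none z))
  ; spoke = spoke
  -- If the partner of `v` were one end of the chosen edge, then `v` would be the other end.
  ; partner∉ = λ v v∉ → cong₂ _∨_
      (==F-false (λ z≡v′ → proj₂ (∉⇒≢ v v∉) (trans (cong partner z≡v′) (involutive v))))
      (==F-false (λ l≡v′ → proj₁ (∉⇒≢ v v∉) (trans (sym (involutive z)) (trans (cong partner l≡v′) (involutive v)))))
  ; partner-involutive = λ v _ → involutive v
  ; partner-adj = λ v _ → partner-adj v }
  where
  z = fzero
  l = partner z
  inEdge : Fin (suc b) → Bool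
  inEdge v = (z ==F v) ∨ (l ==F v)
  involutive : ∀ v → partner (partner v) ≡ v
  involutive v = proj₁ (proj₂ (proj₂ (matched v (none v))))
  partner-adj : ∀ v → T (adj B v (partner v))
  partner-adj v = from T-≡ (proj₂ (proj₂ (proj₂ (matched v (none v)))))
  ∉⇒≢ : ∀ v → inEdge v ≡ false → z ≢ v × l ≢ v
  ∉⇒≢ v v∉ with z Fin.≟ v | l Fin.≟ v
  ... | no z≢v | no l≢v = z≢v , l≢v
  spoke : ∀ w → inEdge w ≡ true → w ≢ z → T (adj B z w)
  spoke w w∈ w≢z with z Fin.≟ w | l Fin.≟ w
  ... | yes z≡w | _ = contradiction (sym z≡w) w≢z
  ... | no _ | yes l≡w = subst (λ w → T (adj B z w)) l≡w (partner-adj z)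

theorem1p4 : ∀ {b : ℕ} (B : Adj b) → SimpleGraph B → Bipartite B → CoveredByEdgesAndStar B →
    (e : ℕ → ℕ) →
    (∀ (M : ℕ) → ∃[ n₀ ] (∀ (n : ℕ) → n₀ ≤ n → M * n ≤ e n)) →
    (∀ (n : ℕ) → 4 * e n ≤ n * n) →
    ∀ (k : ℕ) → 1 ≤ k → ∃[ n₀ ] (∀ (n : ℕ) → n₀ ≤ n →
    (k * exBip n (e n) B ≤ suc k * N B (Ben n (e n)))
    × ((k ∸ 1) * N B (Ben n (e n)) ≤ k * exBip n (e n) B))
theorem1p4 {b} B _ _ covered e e-large 4e≤n² k _ = 2 ⊔ n₁ , λ n n₀≤n →
  let threshold = threshold-at n n₀≤n in
  *-exBip-lub k B (upper b B covered n (≤-trans (*-monoˡ-≤ n (n≤1+n M)) (M*n≤e n n₀≤n)) threshold) ,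
  -- For the lower estimate it suffices that `Ben n (e n)` competes in the maximum.
  *-mono-≤ (m∸n≤m k 1) (N≤exBip B (Ben n (e n)) (Ben-admissible threshold))
  where
  M = suc k * b * suc b
  -- `suc M` yields the `M * n` of the comparison and one more `n`, which keeps `e n` positive even
  -- when `M` is 0.
  n₁ = proj₁ (e-large (suc M))
  M*n≤e : ∀ n → 2 ⊔ n₁ ≤ n → suc M * n ≤ e n
  M*n≤e n n₀≤n = proj₂ (e-large (suc M)) n (m⊔n≤o⇒n≤o 2 n₁ n₀≤n)
  threshold-at : ∀ n → 2 ⊔ n₁ ≤ n → Threshold n (e n) (tParam n (e n))
  threshold-at n n₀≤n = tParam-threshold 2≤n
    (<-≤-trans (<-≤-trans (s≤s z≤n) 2≤n) (≤-trans (m≤m+n n (M * n)) (M*n≤e n n₀≤n))) (4e≤n² n)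
    where
    2≤n = m⊔n≤o⇒m≤o 2 n₁ n₀≤n
  Ben-admissible : ∀ {n e} → Threshold n e (tParam n e) → T (admissible e (Ben n e))
  Ben-admissible {n} {e} th = admissible⁺ (Ben n e) simple inA proper edgeCount-Ben
    where open BenGraph th
  upper : ∀ b (B : Adj b) → CoveredByEdgesAndStar B → ∀ n → suc k * b * suc b * n ≤ e n → Threshold n (e n) (tParam n (e n)) →
    ∀ (G : Adj n) → T (admissible (e n) G) → k * N B G ≤ suc k * N B (Ben n (e n))
  -- Both copy counts compute to 1.
  upper zero B _ n _ _ G _ = *-monoˡ-≤ 1 (n≤1+n k)
  upper (suc b) B covered n large threshold = N-bound B (starCover B covered) k large threshold
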